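{- For every $n,\lambda\in\mathbb{N}$ with $n\ge3$, and each $\mu\in\{0,\dots,\lambda\}$, we have $$OP_{\Gamma_n,\operatorname{Aut}(\Gamma_n)}(\lambda,\mu)=\frac12\,OP_{\Gamma_n,\operatorname{Rot}(\Gamma_n)}(\lambda,\mu)+\frac{\lambda-\mu}{2}\,P_{\Pi_{(n-3)/2}}(\lambda,\mu)$$ if $n$ is odd, and $$OP_{\Gamma_n,\operatorname{Aut}(\Gamma_n)}(\lambda,\mu)=\frac12\,OP_{\Gamma_n,\operatorname{Rot}(\Gamma_n)}(\lambda,\mu)+\frac14\,P_{\Pi_{n/2}}(\lambda,\mu)+\frac{(\lambda-\mu)^2}{4}\,P_{\Pi_{n/2-3}}(\lambda,\mu)$$ if $n$ is even, where $\Pi_{ -1}$ is interpreted as the empty graph.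
   Context: $\mathbb{N}$ denotes the positive integers. $\Gamma_n$ is the cycle of length $n$, with vertex set $\{0,\dots,n-1\}$ and edges $\{v,(v+1)\bmod n\}$ for $v=0,\dots,n-1$. $\Pi_n$ is the path of length $n$ (with $n+1$ vertices). $\operatorname{Aut}(\Gamma)$ is the automorphism group of a graph $\Gamma$, viewed as a group of permutations of the vertices; for $n\ge3$, $\operatorname{Aut}(\Gamma_n)$ is the dihedral group of order $2n$. $\operatorname{Rot}(\Gamma_n)=\{r_0,\dots,r_{n-1}\}$ is the subgroup of rotations, where $r_m(v)=(v+m)\bmod n$. A $\lambda$-coloring of $\Gamma$ is a map $f$ from the vertex set of $\Gamma$ to $\{1,\dots,\lambda\}$; it is $\mu$-proper if for every pair of adjacent vertices $v,w$, either $f(v)\ne f(w)$ or $f(v)=f(w)>\mu$. $P_\Gamma(\lambda,\mu)$ is the number of $\mu$-proper $\lambda$-colorings of $\Gamma$ (so it equals $1$ for the empty graph). For a subgroup $G$ of $\operatorname{Aut}(\Gamma)$, $OP_{\Gamma,G}(\lambda,\mu)$ is the number of equivalence classes of $\mu$-proper $\lambda$-colorings of $\Gamma$, where $f$ and $f'$ are equivalent if $f'=f\circ g$ for some $g\in G$. -}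

module Defs where

open import Data.Fin.Base using (Fin; zero; suc; toℕ; punchIn)
open import Data.Fin.Permutation using (Permutation′; _⟨$⟩ʳ_; _⟨$⟩ˡ_; _≈_; _∘ₚ_; flip; inverseˡ; inverseʳ; insert; remove; insert-punchIn; insert-remove)
import Data.Fin.Permutation as Perm
open import Data.Fin.Properties using (any?; all?; _≟_; toℕ-fromℕ<; toℕ-injective; toℕ<n)
open import Data.Integer.Base using (ℤ; +_; -[1+_])
open import Data.List.Base using (List; []; _∷_; length; lookup; deduplicate; allFin; cartesianProductWith; mapMaybe)
open import Data.List.Membership.Propositional.Properties using (∈-allFin; ∈-lookup)
import Data.List.Relation.Unary.All as All
import Data.List.Relation.Unary.AllPairs as AllPairs
open import Data.List.Relation.Unary.Any as Any using (Any; here; there)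
import Data.List.Relation.Unary.Any.Properties as AnyP
open import Data.List.Relation.Unary.Enumerates.Setoid using (IsEnumeration)
open import Data.List.Relation.Unary.Enumerates.Setoid.Properties using (deduplicate⁺; lookup-surjective)
open import Data.List.Relation.Unary.Unique.DecSetoid.Properties using (deduplicate-!)
open import Data.List.Relation.Unary.Unique.Setoid using (Unique)
open import Data.Maybe.Base using (Maybe; just; nothing)
import Data.Maybe.Relation.Unary.Any as MAny
open import Data.Nat.Base using (ℕ; zero; suc; _+_; _∸_; _<_; NonZero)
open import Data.Nat.DivMod using (_%_; _mod_; m%n%n≡m%n; [m+n]%n≡m%n; m<n⇒m%n≡m; %-distribˡ-+; m%n<n)
open import Data.Nat.Properties using (_<?_; +-assoc; +-comm; +-identityʳ; m+[n∸m]≡n; <⇒≤)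
import Data.Nat.Properties as ℕ
open import Data.Product.Base using (Σ; ∃; ∃-syntax; _×_; _,_; proj₁)
open import Data.Rational.Base using (ℚ; _/_)
open import Data.Sum.Base as Sum using (_⊎_; inj₁; inj₂)
open import Function.Base using (_∘_)
open import Function.Bundles using (Bijection; Equivalence; _⇔_; mk⇔)
open import Function.Definitions using (Injective)
open import Level using (0ℓ)
open import Relation.Binary.Bundles using (Setoid; DecSetoid)
open import Relation.Binary.Core using (Rel)
open import Relation.Binary.Definitions using (Decidable; Symmetric)
open import Relation.Binary.PropositionalEquality using (_≡_; _≢_; refl; sym; trans; cong; module ≡-Reasoning)
import Relation.Binary.PropositionalEquality as ≡
open import Relation.Nullary using (Dec; yes; no; contradiction)
open import Relation.Nullary.Decidable using (map′; ¬?; _×-dec_; _⊎-dec_; _→-dec_)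

------------------------------------------------------------------------
-- Cardinality of a setoid

record Finite (S : Setoid 0ℓ 0ℓ) : Set where
  field
    size      : ℕ
    bijection : Bijection (≡.setoid (Fin size)) S

lookup-injective : ∀ (S : Setoid 0ℓ 0ℓ) {xs} → Unique S xs →
                   Injective _≡_ (Setoid._≈_ S) (lookup xs)
lookup-injective S = go
  where
  open Setoid S using () renaming (_≈_ to _~_; sym to ~-sym)
  go : ∀ {xs} → Unique S xs → ∀ {i j} → lookup xs i ~ lookup xs j → i ≡ j
  go (_ AllPairs.∷ _)  {zero}  {zero}  _  = refl
  go (p AllPairs.∷ _)  {zero}  {suc j} eq = contradiction eq (All.lookup p (∈-lookup j))
  go (p AllPairs.∷ _)  {suc i} {zero}  eq = contradiction (~-sym eq) (All.lookup p (∈-lookup i))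
  go (_ AllPairs.∷ ps) {suc i} {suc j} eq = cong suc (go ps eq)

finite : ∀ (S : DecSetoid 0ℓ 0ℓ) xs → IsEnumeration (DecSetoid.setoid S) xs →
         Finite (DecSetoid.setoid S)
finite S xs enum = record
  { size      = length ys
  ; bijection = record
    { to        = lookup ys
    ; cong      = λ { refl → ~-refl }
    ; bijective = lookup-injective setoid (deduplicate-! S xs)
                , lookup-surjective setoid (deduplicate⁺ S enum)
    }
  }
  where
  open DecSetoid S using (setoid) renaming (_≟_ to _~?_; refl to ~-refl)
  ys = deduplicate _~?_ xs

------------------------------------------------------------------------
-- Graphs and their automorphisms

-- Loops are permitted: the cycle of length 1 below has one.
record Graph : Set₁ where
  field
    order   : ℕ
    Adj     : Rel (Fin order) 0ℓ
    adj?    : Decidable Adj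
    adj-sym : Symmetric Adj

  Vertex : Set
  Vertex = Fin order

open Graph public

IsAutomorphism : (Γ : Graph) → Permutation′ (order Γ) → Set
IsAutomorphism Γ π = ∀ v w → Adj Γ v w ⇔ Adj Γ (π ⟨$⟩ʳ v) (π ⟨$⟩ʳ w)

-- Membership is required to be decidable, which is automatic in classical
-- logic; it is what makes the number of orbits of colorings computable.
record Subgroup (Γ : Graph) : Set₁ where
  infix 4 _∈G
  field
    _∈G          : Permutation′ (order Γ) → Set
    _∈G?         : ∀ π → Dec (π ∈G)
    resp         : ∀ {π ρ} → π ≈ ρ → π ∈G → ρ ∈G
    automorphism : ∀ {π} → π ∈G → IsAutomorphism Γ π
    id∈          : Perm.id ∈G
    ∘∈           : ∀ {π ρ} → π ∈G → ρ ∈G → (π ∘ₚ ρ) ∈G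
    flip∈        : ∀ {π} → π ∈G → flip π ∈G

Aut : (Γ : Graph) → Subgroup Γ
Aut Γ = record
  { _∈G          = IsAutomorphism Γ
  ; _∈G?         = λ π → all? λ v → all? λ w →
                     map′ (λ (f , g) → mk⇔ f g) (λ e → to e , from e)
                       ((adj? Γ v w →-dec adj? Γ (π ⟨$⟩ʳ v) (π ⟨$⟩ʳ w))
                         ×-dec (adj? Γ (π ⟨$⟩ʳ v) (π ⟨$⟩ʳ w) →-dec adj? Γ v w))
  ; resp         = λ π≈ρ aut v w → mk⇔
                     (≡.subst₂ (Adj Γ) (π≈ρ v) (π≈ρ w) ∘ to (aut v w))
                     (from (aut v w) ∘ ≡.subst₂ (Adj Γ) (sym (π≈ρ v)) (sym (π≈ρ w)))
  ; automorphism = λ aut → aut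
  ; id∈          = λ v w → mk⇔ (λ a → a) (λ a → a)
  ; ∘∈           = λ {π} autπ autρ v w → mk⇔
                     (to (autρ (π ⟨$⟩ʳ v) (π ⟨$⟩ʳ w)) ∘ to (autπ v w))
                     (from (autπ v w) ∘ from (autρ (π ⟨$⟩ʳ v) (π ⟨$⟩ʳ w)))
  ; flip∈        = λ {π} aut v w → mk⇔
                     (from (aut (π ⟨$⟩ˡ v) (π ⟨$⟩ˡ w))
                       ∘ ≡.subst₂ (Adj Γ) (sym (inverseʳ π)) (sym (inverseʳ π)))
                     (≡.subst₂ (Adj Γ) (inverseʳ π) (inverseʳ π)
                       ∘ to (aut (π ⟨$⟩ˡ v) (π ⟨$⟩ˡ w)))
  }
  where open Equivalence using (to; from)

------------------------------------------------------------------------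
-- Cycles and paths

rotate : ∀ {n} .{{_ : NonZero n}} → ℕ → Fin n → Fin n
rotate {n} m v = (toℕ v + m) mod n

cycle : (n : ℕ) .{{_ : NonZero n}} → Graph
cycle n = record
  { order   = n
  ; Adj     = λ v w → w ≡ rotate 1 v ⊎ v ≡ rotate 1 w
  ; adj?    = λ v w → (w ≟ rotate 1 v) ⊎-dec (v ≟ rotate 1 w)
  ; adj-sym = Sum.swap
  }

-- Indexed by length, so that path (+ n) has n + 1 vertices and
-- path (-[1+ 0 ]) is the empty graph.
path : ℤ → Graph
path n = record
  { order   = vertices n
  ; Adj     = λ v w → toℕ w ≡ suc (toℕ v) ⊎ toℕ v ≡ suc (toℕ w)
  ; adj?    = λ v w → (toℕ w ℕ.≟ suc (toℕ v)) ⊎-dec (toℕ v ℕ.≟ suc (toℕ w))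
  ; adj-sym = Sum.swap
  }
  where
  vertices : ℤ → ℕ
  vertices (+ n)    = suc n
  vertices -[1+ _ ] = 0

module _ {n : ℕ} .{{_ : NonZero n}} where
  open ≡-Reasoning

  toℕ-rotate : ∀ m (v : Fin n) → toℕ (rotate m v) ≡ (toℕ v + m) % n
  toℕ-rotate m v = toℕ-fromℕ< (m%n<n (toℕ v + m) n)

  rotate-rotate : ∀ a b (v : Fin n) → rotate b (rotate a v) ≡ rotate (a + b) v
  rotate-rotate a b v = toℕ-injective (begin
    toℕ (rotate b (rotate a v))            ≡⟨ toℕ-rotate b (rotate a v) ⟩
    (toℕ (rotate a v) + b) % n             ≡⟨ cong (λ k → (k + b) % n) (toℕ-rotate a v) ⟩
    ((toℕ v + a) % n + b) % n              ≡⟨ %-distribˡ-+ ((toℕ v + a) % n) b n ⟩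
    ((toℕ v + a) % n % n + b % n) % n      ≡⟨ cong (λ k → (k + b % n) % n) (m%n%n≡m%n (toℕ v + a) n) ⟩
    ((toℕ v + a) % n + b % n) % n          ≡⟨ %-distribˡ-+ (toℕ v + a) b n ⟨
    (toℕ v + a + b) % n                    ≡⟨ cong (_% n) (+-assoc (toℕ v) a b) ⟩
    (toℕ v + (a + b)) % n                  ≡⟨ toℕ-rotate (a + b) v ⟨
    toℕ (rotate (a + b) v)                 ∎)

  rotate-0 : ∀ (v : Fin n) → rotate 0 v ≡ v
  rotate-0 v = toℕ-injective (begin
    toℕ (rotate 0 v) ≡⟨ toℕ-rotate 0 v ⟩
    (toℕ v + 0) % n  ≡⟨ cong (_% n) (+-identityʳ (toℕ v)) ⟩
    toℕ v % n        ≡⟨ m<n⇒m%n≡m (toℕ<n v) ⟩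
    toℕ v            ∎)

  rotate-n : ∀ (v : Fin n) → rotate n v ≡ v
  rotate-n v = toℕ-injective (begin
    toℕ (rotate n v) ≡⟨ toℕ-rotate n v ⟩
    (toℕ v + n) % n  ≡⟨ [m+n]%n≡m%n (toℕ v) n ⟩
    toℕ v % n        ≡⟨ m<n⇒m%n≡m (toℕ<n v) ⟩
    toℕ v            ∎)

  rotate-comm : ∀ a b (v : Fin n) → rotate b (rotate a v) ≡ rotate a (rotate b v)
  rotate-comm a b v = begin
    rotate b (rotate a v) ≡⟨ rotate-rotate a b v ⟩
    rotate (a + b) v      ≡⟨ cong (λ k → rotate k v) (+-comm a b) ⟩
    rotate (b + a) v      ≡⟨ rotate-rotate b a v ⟨
    rotate a (rotate b v) ∎

  rotate-mod : ∀ m (v : Fin n) → rotate (toℕ (m mod n)) v ≡ rotate m v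
  rotate-mod m v = toℕ-injective (begin
    toℕ (rotate (toℕ (m mod n)) v)   ≡⟨ toℕ-rotate (toℕ (m mod n)) v ⟩
    (toℕ v + toℕ (m mod n)) % n      ≡⟨ cong (λ k → (toℕ v + k) % n) (toℕ-fromℕ< (m%n<n m n)) ⟩
    (toℕ v + m % n) % n              ≡⟨ %-distribˡ-+ (toℕ v) (m % n) n ⟩
    (toℕ v % n + m % n % n) % n      ≡⟨ cong (λ k → (toℕ v % n + k) % n) (m%n%n≡m%n m n) ⟩
    (toℕ v % n + m % n) % n          ≡⟨ %-distribˡ-+ (toℕ v) m n ⟨
    (toℕ v + m) % n                  ≡⟨ toℕ-rotate m v ⟨
    toℕ (rotate m v)                 ∎)

IsRotation : ∀ {n} .{{_ : NonZero n}} → Permutation′ n → Set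
IsRotation {n} π = ∃[ m ] ∀ v → π ⟨$⟩ʳ v ≡ rotate (toℕ {n} m) v

module _ {n : ℕ} .{{_ : NonZero n}} where
  open ≡-Reasoning

  isRotation : ∀ {π} m → (∀ (v : Fin n) → π ⟨$⟩ʳ v ≡ rotate m v) → IsRotation π
  isRotation m eq = m mod n , λ v → trans (eq v) (sym (rotate-mod m v))

  rotation-flip : ∀ {π : Permutation′ n} → IsRotation π → IsRotation (flip π)
  rotation-flip {π} (m , eq) = isRotation {flip π} (n ∸ toℕ m) λ v → begin
    π ⟨$⟩ˡ v                                        ≡⟨ rotate-n _ ⟨
    rotate n (π ⟨$⟩ˡ v)                             ≡⟨ cong (λ k → rotate k (π ⟨$⟩ˡ v)) (m+[n∸m]≡n (<⇒≤ (toℕ<n m))) ⟨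
    rotate (toℕ m + (n ∸ toℕ m)) (π ⟨$⟩ˡ v)         ≡⟨ rotate-rotate (toℕ m) (n ∸ toℕ m) _ ⟨
    rotate (n ∸ toℕ m) (rotate (toℕ m) (π ⟨$⟩ˡ v))  ≡⟨ cong (rotate (n ∸ toℕ m)) (eq (π ⟨$⟩ˡ v)) ⟨
    rotate (n ∸ toℕ m) (π ⟨$⟩ʳ (π ⟨$⟩ˡ v))          ≡⟨ cong (rotate (n ∸ toℕ m)) (inverseʳ π) ⟩
    rotate (n ∸ toℕ m) v                            ∎

  rotation-automorphism : ∀ {π : Permutation′ n} → IsRotation π → IsAutomorphism (cycle n) π
  rotation-automorphism {π} (m , eq) v w =
    mk⇔ (Sum.map forth forth) (Sum.map back back)
    where
    step : ∀ x → π ⟨$⟩ʳ rotate 1 x ≡ rotate 1 (π ⟨$⟩ʳ x)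
    step x = begin
      π ⟨$⟩ʳ rotate 1 x         ≡⟨ eq (rotate 1 x) ⟩
      rotate (toℕ m) (rotate 1 x) ≡⟨ rotate-comm 1 (toℕ m) x ⟩
      rotate 1 (rotate (toℕ m) x) ≡⟨ cong (rotate 1) (eq x) ⟨
      rotate 1 (π ⟨$⟩ʳ x)       ∎
    forth : ∀ {x y} → y ≡ rotate 1 x → π ⟨$⟩ʳ y ≡ rotate 1 (π ⟨$⟩ʳ x)
    forth {x} refl = step x
    back : ∀ {x y} → π ⟨$⟩ʳ y ≡ rotate 1 (π ⟨$⟩ʳ x) → y ≡ rotate 1 x
    back {x} {y} p = begin
      y                             ≡⟨ inverseˡ π ⟨
      π ⟨$⟩ˡ (π ⟨$⟩ʳ y)             ≡⟨ cong (π ⟨$⟩ˡ_) (trans p (sym (step x))) ⟩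
      π ⟨$⟩ˡ (π ⟨$⟩ʳ rotate 1 x)    ≡⟨ inverseˡ π ⟩
      rotate 1 x                    ∎

Rot : (n : ℕ) .{{_ : NonZero n}} → Subgroup (cycle n)
Rot n = record
  { _∈G          = IsRotation
  ; _∈G?         = λ π → any? λ m → all? λ v → π ⟨$⟩ʳ v ≟ rotate (toℕ m) v
  ; resp         = λ { π≈ρ (m , eq) → m , λ v → trans (sym (π≈ρ v)) (eq v) }
  ; automorphism = λ {π} → rotation-automorphism {n} {π}
  ; id∈          = isRotation {n} {Perm.id} 0 λ v → sym (rotate-0 v)
  ; ∘∈           = λ { {π} {ρ} (a , eqπ) (b , eqρ) →
                       isRotation {n} {π ∘ₚ ρ} (toℕ a + toℕ b) λ v →
                         trans (eqρ (π ⟨$⟩ʳ v))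
                           (trans (cong (rotate (toℕ b)) (eqπ v))
                                  (rotate-rotate (toℕ a) (toℕ b) v)) }
  ; flip∈        = λ {π} → rotation-flip {n} {π}
  }

------------------------------------------------------------------------
-- Colorings

-- The colors 1, …, ℓ are represented by Fin ℓ.
color : ∀ {ℓ} → Fin ℓ → ℕ
color c = suc (toℕ c)

Coloring : Graph → ℕ → Set
Coloring Γ ℓ = Vertex Γ → Fin ℓ

Proper : (Γ : Graph) (ℓ μ : ℕ) → Coloring Γ ℓ → Set
Proper Γ ℓ μ f = ∀ v w → Adj Γ v w → f v ≢ f w ⊎ (f v ≡ f w × μ < color (f v))

proper? : ∀ Γ ℓ μ f → Dec (Proper Γ ℓ μ f)
proper? Γ ℓ μ f = all? λ v → all? λ w →
  adj? Γ v w →-dec (¬? (f v ≟ f w) ⊎-dec ((f v ≟ f w) ×-dec (μ <? color (f v))))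

ProperColoring : Graph → ℕ → ℕ → Set
ProperColoring Γ ℓ μ = Σ (Coloring Γ ℓ) (Proper Γ ℓ μ)

proper-resp : ∀ Γ ℓ μ {f f′} → (∀ v → f′ v ≡ f v) → Proper Γ ℓ μ f → Proper Γ ℓ μ f′
proper-resp Γ ℓ μ eq p v w a rewrite eq v | eq w = p v w a

functions : ∀ n ℓ → List (Fin n → Fin ℓ)
functions zero    ℓ = (λ ()) ∷ []
functions (suc n) ℓ = cartesianProductWith
  (λ { c f zero → c ; c f (suc v) → f v }) (allFin ℓ) (functions n ℓ)

functions-complete : ∀ n ℓ (f : Fin n → Fin ℓ) → Any (λ g → ∀ v → g v ≡ f v) (functions n ℓ)
functions-complete zero    ℓ f = here λ ()
functions-complete (suc n) ℓ f = AnyP.cartesianProductWith⁺ _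
  (λ { refl eq zero → refl ; refl eq (suc v) → eq v })
  (∈-allFin (f zero)) (functions-complete n ℓ (f ∘ suc))

module _ (Γ : Graph) (ℓ μ : ℕ) where

  -- Functions are compared pointwise, in the absence of extensionality.
  _≈ᶜ_ : Rel (ProperColoring Γ ℓ μ) 0ℓ
  (f , _) ≈ᶜ (f′ , _) = ∀ v → f′ v ≡ f v

  restrict : Coloring Γ ℓ → Maybe (ProperColoring Γ ℓ μ)
  restrict f with proper? Γ ℓ μ f
  ... | yes p = just (f , p)
  ... | no  _ = nothing

  properColorings : List (ProperColoring Γ ℓ μ)
  properColorings = mapMaybe restrict (functions (order Γ) ℓ)

  properColorings-complete : ∀ f → Any (f ≈ᶜ_) properColorings
  properColorings-complete (f , p) = AnyP.mapMaybe⁺ restrict _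
    (AnyP.map⁺ (Any.map restrict⁺ (functions-complete (order Γ) ℓ f)))
    where
    restrict⁺ : ∀ {g} → (∀ v → g v ≡ f v) → MAny.Any ((f , p) ≈ᶜ_) (restrict g)
    restrict⁺ {g} eq with proper? Γ ℓ μ g
    ... | yes _ = MAny.just eq
    ... | no ¬p = contradiction (proper-resp Γ ℓ μ eq p) ¬p

  coloringDecSetoid : DecSetoid 0ℓ 0ℓ
  coloringDecSetoid = record
    { Carrier = ProperColoring Γ ℓ μ
    ; _≈_     = _≈ᶜ_
    ; isDecEquivalence = record
      { isEquivalence = record
        { refl  = λ v → refl
        ; sym   = λ eq v → sym (eq v)
        ; trans = λ eq eq′ v → trans (eq′ v) (eq v)
        }
      ; _≟_ = λ (f , _) (f′ , _) → all? λ v → f′ v ≟ f v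
      }
    }

  colorings-finite : Finite (DecSetoid.setoid coloringDecSetoid)
  colorings-finite = finite coloringDecSetoid properColorings properColorings-complete

P : (Γ : Graph) (ℓ μ : ℕ) → ℕ
P Γ ℓ μ = Finite.size (colorings-finite Γ ℓ μ)

------------------------------------------------------------------------
-- Colorings up to the action of a subgroup

insert-cong : ∀ {n} j {π ρ : Permutation′ n} → π ≈ ρ → insert zero j π ≈ insert zero j ρ
insert-cong j         π≈ρ zero    = refl
insert-cong j {π} {ρ} π≈ρ (suc i) =
  trans (insert-punchIn zero j π i)
    (trans (cong (punchIn j) (π≈ρ i)) (sym (insert-punchIn zero j ρ i)))

anyPermutation? : ∀ {n} {Q : Permutation′ n → Set} →
                  (∀ {π ρ} → π ≈ ρ → Q π → Q ρ) → (∀ π → Dec (Q π)) → Dec (∃ Q)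
anyPermutation? {zero}  resp Q? =
  map′ (Perm.id ,_) (λ (π , q) → resp {π} {Perm.id} (λ ()) q) (Q? Perm.id)
anyPermutation? {suc n} resp Q? =
  map′ (λ (j , π , q) → insert zero j π , q)
       (λ (π , q) → π ⟨$⟩ʳ zero , remove zero π
                  , resp {π} {insert zero (π ⟨$⟩ʳ zero) (remove zero π)}
                      (λ i → sym (insert-remove zero π i)) q)
       (any? λ j → anyPermutation?
         (λ {π} {ρ} π≈ρ → resp {insert zero j π} {insert zero j ρ} (insert-cong j {π} {ρ} π≈ρ))
         (λ π → Q? (insert zero j π)))

module _ (Γ : Graph) (G : Subgroup Γ) (ℓ μ : ℕ) where
  open Subgroup G

  _∼_ : Rel (ProperColoring Γ ℓ μ) 0ℓ
  (f , _) ∼ (f′ , _) = ∃[ g ] g ∈G × (∀ v → f′ v ≡ f (g ⟨$⟩ʳ v))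

  _∼?_ : Decidable _∼_
  (f , _) ∼? (f′ , _) = anyPermutation?
    (λ {π} {ρ} π≈ρ (g∈ , eq) → resp {π} {ρ} π≈ρ g∈ , λ v → trans (eq v) (cong f (π≈ρ v)))
    (λ g → (g ∈G?) ×-dec all? λ v → f′ v ≟ f (g ⟨$⟩ʳ v))

  orbitDecSetoid : DecSetoid 0ℓ 0ℓ
  orbitDecSetoid = record
    { Carrier = ProperColoring Γ ℓ μ
    ; _≈_     = _∼_
    ; isDecEquivalence = record
      { isEquivalence = record
        { refl  = Perm.id , id∈ , λ v → refl
        ; sym   = λ {x} (g , g∈ , eq) → flip g , flip∈ {g} g∈ , λ v →
                    trans (cong (proj₁ x) (sym (inverseʳ g))) (sym (eq (g ⟨$⟩ˡ v)))
        ; trans = λ (g , g∈ , eq) (h , h∈ , eq′) → h ∘ₚ g , ∘∈ {h} {g} h∈ g∈ , λ v →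
                    trans (eq′ v) (eq (h ⟨$⟩ʳ v))
        }
      ; _≟_ = _∼?_
      }
    }

  orbits-finite : Finite (DecSetoid.setoid orbitDecSetoid)
  orbits-finite = finite orbitDecSetoid (properColorings Γ ℓ μ) λ f →
    Any.map (λ eq → Perm.id , id∈ , eq) (properColorings-complete Γ ℓ μ f)

OP : (Γ : Graph) (G : Subgroup Γ) (ℓ μ : ℕ) → ℕ
OP Γ G ℓ μ = Finite.size (orbits-finite Γ G ℓ μ)

ℕ→ℚ : ℕ → ℚ
ℕ→ℚ k = + k / 1

{-# OPTIONS --safe #-}
-- The dihedral group is the rotation group together with its n reflections, so two
-- applications of Burnside's lemma give 2n OP_Aut = n OP_Rot + Σ fix(s) over the
-- reflections s. Conjugation by rotations leaves one value of fix(s) if n is odd and two,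
-- each occurring n/2 times, if n is even. A coloring fixed by s is a coloring of the
-- quotient of the cycle by s: a path, with a loop at an end for every edge that s flips.
-- A looped vertex carries one of the λ - μ colors above μ and then imposes nothing on its
-- neighbours, so it can be deleted at the cost of a factor λ - μ.
module Submission where

open import Defs
open import Algebra.Properties.CommutativeMonoid.Sum using ()
open import Data.Bool.Base using (if_then_else_)
open import Data.Fin.Base using (Fin; zero; suc; toℕ; fromℕ; fromℕ<; punchIn; opposite; reduce≥; _↑ʳ_)
open import Data.Fin.Permutation using (Permutation; Permutation′; permutation; insert; insert-punchIn; _⟨$⟩ʳ_; _⟨$⟩ˡ_; flip; inverseˡ; inverseʳ; reverse; _∘ₚ_; ↔⇒≡)
import Data.Fin.Permutation as Perm
open import Data.Fin.Properties using (_≟_; toℕ-↑ʳ; ↑ʳ-injective; *↔×; punchInᵢ≢i; toℕ-injective; toℕ<n; toℕ-fromℕ; toℕ-fromℕ<; opposite-prop; opposite-involutive)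
open import Data.Integer.Base as ℤ using (ℤ; +_)
import Data.Integer.Properties as ℤ
open import Data.Nat.Base using (ℕ; zero; suc; NonZero; _≤_; _<_; z≤n; s≤s; s≤s⁻¹; _∸_; _⊓_; ∣_-_∣) renaming (_/_ to _div_; _+_ to _+ℕ_; _*_ to _*ℕ_)
open import Data.Nat.Divisibility using (_∣_; _∤_; divides; m%n≡0⇒n∣m)
open import Data.Nat.DivMod using (_%_; _mod_; m≡m%n+[m/n]*n; m*n/n≡m; m<n⇒m%n≡m; n%n≡0; m%n<n)
import Data.Nat.Properties as ℕ
open import Data.Nat.Solver renaming (module +-*-Solver to ℕ-Solver)
open import Data.Product.Base using (∃; _×_; _,_; proj₁; proj₂)
open import Data.Product.Function.NonDependent.Setoid using (_×-inverse_)
open import Data.Product.Relation.Binary.Pointwise.NonDependent using (_×ₛ_; Pointwise-≡↔≡)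
open import Data.Rational.Base using (ℚ; ½; _/_; _+_; _-_; _*_)
import Data.Rational.Properties as ℚ
open import Data.Rational.Solver renaming (module +-*-Solver to ℚ-Solver)
open import Data.Rational.Unnormalised.Base using (mkℚᵘ; *≡*)
import Data.Rational.Unnormalised.Properties as ℚᵘ
open import Data.Sum.Base as Sum using (_⊎_; inj₁; inj₂)
open import Data.Vec.Functional using (removeAt)
open import Function.Base using (_∘_; _$_)
open import Function.Bundles using (Bijection; Inverse; Equivalence; _⇔_; mk⇔)
open import Function.Properties.Bijection using (Bijection⇒Inverse)
import Function.Properties.Inverse as Inv
open import Level using (0ℓ)
open import Relation.Binary.Bundles using (Setoid; DecSetoid)
open import Relation.Binary.Definitions using (Tri; tri<; tri≈; tri>)
open import Relation.Binary.Structures using (IsEquivalence)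
open import Relation.Binary.PropositionalEquality using (_≡_; _≢_; refl; sym; trans; cong; cong₂; module ≡-Reasoning)
import Relation.Binary.PropositionalEquality as ≡
open import Relation.Nullary using (¬_; Dec; yes; no; contradiction; does)
open import Relation.Nullary.Decidable using (dec-true; dec-false; _×-dec_; _⊎-dec_)

open Algebra.Properties.CommutativeMonoid.Sum ℕ.+-0-commutativeMonoid
open ≡-Reasoning

-- A subgroup here is a predicate on permutations, not a list of them, so there is nothing to sum
-- over. The `n` rotations are therefore counted by their index `m`, and the reflections by the same
-- index after a reversal; permutations enter only when the orbit relation is compared with these
-- counts, and for the full group that comparison is `cycle-automorphism`.
--
-- The constants come from the shape of the quotients. For odd `n` a reflection fixes one vertex and
-- flips one edge: the quotient has (n+1)/2 vertices and one loop, and without the looped vertex it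
-- is a path of length (n-3)/2. For even `n` one class fixes two vertices and flips no edge, which
-- gives the path of length n/2; the other fixes no vertex and flips two edges, which gives n/2
-- vertices with two loops and, after two deletions, length n/2 - 3, that is -1 for n = 4. Each even
-- class makes up n/2 of the 2n symmetries, whence the factor 1/4.

χ : {A : Set} → Dec A → ℕ
χ a? = if does a? then 1 else 0

χ-true : {A : Set} (a? : Dec A) → A → χ a? ≡ 1
χ-true a? a = cong (if_then 1 else 0) (dec-true a? a)

χ-false : {A : Set} (a? : Dec A) → ¬ A → χ a? ≡ 0
χ-false a? ¬a = cong (if_then 1 else 0) (dec-false a? ¬a)

χ-cong : {A B : Set} (a? : Dec A) (b? : Dec B) → (A → B) → (B → A) → χ a? ≡ χ b?
χ-cong (yes a) b? f g = sym (χ-true b? (f a))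
χ-cong (no ¬a) b? f g = sym (χ-false b? (¬a ∘ g))

-- Finite sums of natural numbers

sum-const : ∀ n c → ∑[ i < n ] c ≡ n *ℕ c
sum-const zero    c = refl
sum-const (suc n) c = cong (c +ℕ_) (sum-const n c)

sum-zero : ∀ {n} {t : Fin n → ℕ} → (∀ i → t i ≡ 0) → sum t ≡ 0
sum-zero {n} eq = trans (sum-cong-≗ eq) (sum-replicate-zero n)

sum-single : ∀ {n} (t : Fin n → ℕ) i → (∀ j → j ≢ i → t j ≡ 0) → sum t ≡ t i
sum-single {suc n} t i eq = begin
  sum t                       ≡⟨ sum-remove {i = i} t ⟩
  t i +ℕ sum (removeAt t i)   ≡⟨ cong (t i +ℕ_) (sum-zero λ j → eq (punchIn i j) (punchInᵢ≢i i j)) ⟩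
  t i +ℕ 0                    ≡⟨ ℕ.+-identityʳ (t i) ⟩
  t i                         ∎

-- Sums over finite setoids

module _ {S : Setoid 0ℓ 0ℓ} (F : Finite S) where

  enumeration : Inverse (≡.setoid (Fin (Finite.size F))) S
  enumeration = Bijection⇒Inverse (Finite.bijection F)

  element : Fin (Finite.size F) → Setoid.Carrier S
  element = Inverse.to enumeration

  index : Setoid.Carrier S → Fin (Finite.size F)
  index = Inverse.from enumeration

  element-index : ∀ x → Setoid._≈_ S (element (index x)) x
  element-index = Inverse.strictlyInverseˡ enumeration

  element-injective : ∀ {i j} → Setoid._≈_ S (element i) (element j) → i ≡ j
  element-injective = Bijection.injective (Finite.bijection F)

  ∑ₛ : (Setoid.Carrier S → ℕ) → ℕ
  ∑ₛ w = ∑[ i < Finite.size F ] w (element i)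

∑ₛ-permute : {S : Setoid 0ℓ 0ℓ} (F : Finite S) (I : Inverse S S) (w : Setoid.Carrier S → ℕ) →
             (∀ {x y} → Setoid._≈_ S x y → w x ≡ w y) →
             ∑ₛ F (w ∘ Inverse.to I) ≡ ∑ₛ F w
∑ₛ-permute F I w w-cong = sym (begin
  ∑ₛ F w                  ≡⟨ sum-permute (w ∘ element F) π ⟩
  sum (w ∘ element F ∘ (π ⟨$⟩ʳ_))  ≡⟨ sum-cong-≗ (λ i → w-cong (element-index F (Inverse.to I (element F i)))) ⟩
  ∑ₛ F (w ∘ Inverse.to I) ∎)
  where π = Inv.trans (enumeration F) (Inv.trans I (Inv.sym (enumeration F)))

module _ (S : DecSetoid 0ℓ 0ℓ) (F : Finite (DecSetoid.setoid S)) where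
  open DecSetoid S using (Carrier; _≈_) renaming (_≟_ to _≈?_; sym to ≈-sym; trans to ≈-trans)

  ∑ₛ-≈ : ∀ x → ∑ₛ F (λ y → χ (x ≈? y)) ≡ 1
  ∑ₛ-≈ x = trans
    (sum-single _ (index F x) λ j j≢ → χ-false (x ≈? element F j) λ x≈ →
      j≢ (element-injective F (≈-sym (≈-trans (element-index F x) x≈))))
    (χ-true (x ≈? element F (index F x)) (≈-sym (element-index F x)))

  -- Double counting of the pairs (t, x) with `f t ≈ x`: injectivity leaves exactly one `t` for each
  -- `x` in the image, and every `t` has exactly one `x`.
  ∑ₛ-image : {T : Setoid 0ℓ 0ℓ} (G : Finite T) (f : Setoid.Carrier T → Carrier) →
             (∀ {s t} → f s ≈ f t → Setoid._≈_ T s t) →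
             (∀ {s t} → Setoid._≈_ T s t → f s ≈ f t) →
             {Q : Carrier → Set} (Q? : ∀ x → Dec (Q x)) →
             (∀ t {x} → f t ≈ x → Q x) → (∀ {x} → Q x → ∃ λ t → f t ≈ x) →
             ∑ₛ F (χ ∘ Q?) ≡ Finite.size G
  ∑ₛ-image {T} G f f-injective f-cong Q? image⊆Q Q⊆image = begin
    ∑ₛ F (χ ∘ Q?)                                            ≡⟨ sum-cong-≗ (count ∘ element F) ⟩
    ∑ₛ F (λ x → ∑ₛ G (λ t → χ (f t ≈? x)))                   ≡⟨ ∑-comm (λ i j → χ (f (element G j) ≈? element F i)) ⟩
    ∑ₛ G (λ t → ∑ₛ F (λ x → χ (f t ≈? x)))                   ≡⟨ sum-cong-≗ (∑ₛ-≈ ∘ f ∘ element G) ⟩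
    ∑ₛ G (λ _ → 1)                                           ≡⟨ sum-const (Finite.size G) 1 ⟩
    Finite.size G *ℕ 1                                       ≡⟨ ℕ.*-identityʳ _ ⟩
    Finite.size G                                            ∎
    where
    count : ∀ x → χ (Q? x) ≡ ∑ₛ G (λ t → χ (f t ≈? x))
    count x with Q? x
    ... | no ¬q = sym (sum-zero λ j → χ-false (f (element G j) ≈? x) (¬q ∘ image⊆Q (element G j)))
    ... | yes q with t , ft≈x ← Q⊆image q = sym (trans
      (sum-single _ (index G t) λ j j≢ → χ-false (f (element G j) ≈? x) λ fj≈x →
        j≢ (element-injective G (Setoid.trans T (f-injective (≈-trans fj≈x (≈-sym ft≈x)))
                                                (Setoid.sym T (element-index G t)))))
      (χ-true (f (element G (index G t)) ≈? x) (≈-trans (f-cong (element-index G t)) ft≈x)))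

-- Burnside's lemma

toSetoid : {A : Set} {_≈_ : A → A → Set} → IsEquivalence _≈_ → Setoid 0ℓ 0ℓ
toSetoid {A} {_≈_} eq = record { Carrier = A ; _≈_ = _≈_ ; isEquivalence = eq }

-- Burnside's lemma, with the group replaced by the function
-- w y x = #{ g ∣ g y = x }; then w x x is the order of the stabiliser of x.
module _ {A : Set} {_≈_ _∼_ : A → A → Set}
         {≈-equiv : IsEquivalence _≈_} {∼-equiv : IsEquivalence _∼_}
         (X : Finite (toSetoid ≈-equiv))
         (O : Finite (toSetoid ∼-equiv))
         (w : A → A → ℕ) (N : ℕ)
         (w-invariant : ∀ {y y′} x → y ∼ y′ → w y x ≡ w y′ x)
         (w-support : ∀ {y x} → ¬ y ∼ x → w y x ≡ 0)
         (w-total : ∀ y → ∑ₛ X (w y) ≡ N) where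

  burnside : ∑ₛ X (λ x → w x x) ≡ Finite.size O *ℕ N
  burnside = begin
    ∑ₛ X (λ x → w x x)                ≡⟨ sum-cong-≗ (stabiliser ∘ element X) ⟩
    ∑ₛ X (λ x → ∑ₛ O (λ y → w y x))   ≡⟨ ∑-comm (λ i j → w (element O j) (element X i)) ⟩
    ∑ₛ O (λ y → ∑ₛ X (w y))           ≡⟨ sum-cong-≗ (w-total ∘ element O) ⟩
    ∑ₛ O (λ y → N)                    ≡⟨ sum-const (Finite.size O) N ⟩
    Finite.size O *ℕ N                ∎
    where
    module ∼ = IsEquivalence ∼-equiv
    -- Among the orbit representatives only the one equivalent to `x` contributes, and by invariance
    -- it may be replaced by `x` itself.
    stabiliser : ∀ x → w x x ≡ ∑ₛ O (λ y → w y x)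
    stabiliser x = sym (trans
      (sum-single _ (index O x) λ j j≢ → w-support λ j∼x →
        j≢ (element-injective O (∼.trans j∼x (∼.sym (element-index O x)))))
      (w-invariant x (element-index O x)))

-- Rotations, reversal and automorphisms of the cycle

module _ {n : ℕ} where

  opposite-sum : ∀ (v : Fin n) → toℕ (opposite v) +ℕ suc (toℕ v) ≡ n
  opposite-sum v = trans (cong (_+ℕ suc (toℕ v)) (opposite-prop v)) (ℕ.m∸n+n≡m (toℕ<n v))

  opposite-suc-≡ : ∀ {v w : Fin n} → toℕ w ≡ suc (toℕ v) → toℕ (opposite v) ≡ suc (toℕ (opposite w))
  opposite-suc-≡ {v} {w} eq = ℕ.+-cancelʳ-≡ (suc (toℕ v)) _ _ (begin
    toℕ (opposite v) +ℕ suc (toℕ v)         ≡⟨ opposite-sum v ⟩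
    n                                       ≡⟨ opposite-sum w ⟨
    toℕ (opposite w) +ℕ suc (toℕ w)         ≡⟨ cong (λ k → toℕ (opposite w) +ℕ suc k) eq ⟩
    toℕ (opposite w) +ℕ suc (suc (toℕ v))   ≡⟨ ℕ.+-suc _ _ ⟩
    suc (toℕ (opposite w)) +ℕ suc (toℕ v)   ∎)

  module _ .{{_ : NonZero n}} where

    rotate-1-suc : ∀ {v w : Fin n} → toℕ w ≡ suc (toℕ v) → w ≡ rotate 1 v
    rotate-1-suc {v} {w} eq = toℕ-injective $ sym $ begin
      toℕ (rotate 1 v)   ≡⟨ toℕ-rotate 1 v ⟩
      (toℕ v +ℕ 1) % n   ≡⟨ cong (_% n) (trans (ℕ.+-comm (toℕ v) 1) (sym eq)) ⟩
      toℕ w % n          ≡⟨ m<n⇒m%n≡m (toℕ<n w) ⟩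
      toℕ w              ∎

    toℕ-rotate-wrap : ∀ {v : Fin n} → suc (toℕ v) ≡ n → toℕ (rotate 1 v) ≡ 0
    toℕ-rotate-wrap {v} eq = begin
      toℕ (rotate 1 v)   ≡⟨ toℕ-rotate 1 v ⟩
      (toℕ v +ℕ 1) % n   ≡⟨ cong (_% n) (trans (ℕ.+-comm (toℕ v) 1) eq) ⟩
      n % n              ≡⟨ n%n≡0 n ⟩
      0                  ∎

    rotate-1-wrap : ∀ {v w : Fin n} → suc (toℕ v) ≡ n → toℕ w ≡ 0 → w ≡ rotate 1 v
    rotate-1-wrap eq w≡0 = toℕ-injective (trans w≡0 (sym (toℕ-rotate-wrap eq)))

    rotate-1-cases : ∀ (v : Fin n) →
      toℕ (rotate 1 v) ≡ suc (toℕ v) ⊎ (suc (toℕ v) ≡ n × toℕ (rotate 1 v) ≡ 0)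
    rotate-1-cases v with ℕ.m≤n⇒m<n∨m≡n (toℕ<n v)
    ... | inj₂ eq = inj₂ (eq , toℕ-rotate-wrap eq)
    ... | inj₁ lt = inj₁ (trans (cong toℕ (sym (rotate-1-suc (toℕ-fromℕ< lt)))) (toℕ-fromℕ< lt))

    rotate-+n : ∀ m (v : Fin n) → rotate (m +ℕ n) v ≡ rotate m v
    rotate-+n m v = trans (sym (rotate-rotate m n v)) (rotate-n (rotate m v))

    rotate-toℕ-comm : ∀ (v w : Fin n) → rotate (toℕ v) w ≡ rotate (toℕ w) v
    rotate-toℕ-comm v w = toℕ-injective $ begin
      toℕ (rotate (toℕ v) w)   ≡⟨ toℕ-rotate (toℕ v) w ⟩
      (toℕ w +ℕ toℕ v) % n     ≡⟨ cong (_% n) (ℕ.+-comm (toℕ w) (toℕ v)) ⟩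
      (toℕ v +ℕ toℕ w) % n     ≡⟨ toℕ-rotate (toℕ w) v ⟨
      toℕ (rotate (toℕ w) v)   ∎

    private
      -- The index is reduced modulo `n` first, because `n ∸ m` would be cut off at 0 for `m` above
      -- `n`.
      inv : ℕ → ℕ
      inv m = n ∸ toℕ (m mod n)

      rotate-inv : ∀ m (v : Fin n) → rotate (inv m) (rotate m v) ≡ v
      rotate-inv m v = begin
        rotate (inv m) (rotate m v)                 ≡⟨ cong (rotate (inv m)) (rotate-mod m v) ⟨
        rotate (inv m) (rotate (toℕ (m mod n)) v)   ≡⟨ rotate-rotate (toℕ (m mod n)) (inv m) v ⟩
        rotate (toℕ (m mod n) +ℕ inv m) v           ≡⟨ cong (λ k → rotate k v) (ℕ.m+[n∸m]≡n (ℕ.<⇒≤ (toℕ<n (m mod n)))) ⟩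
        rotate n v                                  ≡⟨ rotate-n v ⟩
        v                                           ∎

    rotation : ℕ → Permutation′ n
    rotation m = permutation (rotate m) (rotate (inv m))
      (λ v → trans (rotate-comm (inv m) m v) (rotate-inv m v)) (rotate-inv m)

    rotation-isRotation : ∀ m → IsRotation (rotation m)
    rotation-isRotation m = isRotation {π = rotation m} m λ v → refl

    rotate-injective : ∀ m {v w : Fin n} → rotate m v ≡ rotate m w → v ≡ w
    rotate-injective m {v} {w} eq =
      trans (sym (rotate-inv m v)) (trans (cong (rotate (inv m)) eq) (rotate-inv m w))

    -- Only a cycle of length 1 or 2 brings two steps back to their start. This keeps the two
    -- neighbours of a vertex apart, so that an automorphism has a direction.
    rotate-2-fixpoint-free : 3 ≤ n → ∀ (v : Fin n) → rotate 1 (rotate 1 v) ≢ v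
    rotate-2-fixpoint-free 3≤n v eq with rotate-1-cases v | rotate-1-cases (rotate 1 v)
    ... | inj₁ p | inj₁ q =
      ℕ.m≢1+n+m (toℕ v) (trans (sym (cong toℕ eq)) (trans q (cong suc p)))
    ... | inj₁ p | inj₂ (q , r) =
      ℕ.<⇒≢ 3≤n (trans (cong (2 +ℕ_) (trans (sym r) (cong toℕ eq))) (trans (cong suc (sym p)) q))
    ... | inj₂ (p , q) | inj₁ r =
      ℕ.<⇒≢ 3≤n (trans (cong suc (trans (sym (trans r (cong suc q))) (cong toℕ eq))) p)
    ... | inj₂ (p , q) | inj₂ (r , s) =
      ℕ.<⇒≢ (ℕ.≤-trans (s≤s (s≤s z≤n)) 3≤n) (trans (cong suc (sym q)) r)

    -- The dihedral relation r s r = s, in a form free of inverses, since rotations have natural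
    -- numbers as indices.
    rotate-1-opposite : ∀ (v : Fin n) → rotate 1 (opposite (rotate 1 v)) ≡ opposite v
    rotate-1-opposite v with rotate-1-cases v
    ... | inj₁ p = sym (rotate-1-suc (opposite-suc-≡ p))
    ... | inj₂ (p , q) = sym $ rotate-1-wrap
      (begin
        suc (toℕ (opposite (rotate 1 v)))                     ≡⟨ ℕ.+-comm 1 _ ⟩
        toℕ (opposite (rotate 1 v)) +ℕ 1                      ≡⟨ cong (λ k → toℕ (opposite (rotate 1 v)) +ℕ suc k) q ⟨
        toℕ (opposite (rotate 1 v)) +ℕ suc (toℕ (rotate 1 v)) ≡⟨ opposite-sum (rotate 1 v) ⟩
        n                                                     ∎)
      (trans (opposite-prop v) (trans (cong (n ∸_) p) (ℕ.n∸n≡0 n)))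

    rotate-opposite : ∀ m (v : Fin n) → rotate m (opposite (rotate m v)) ≡ opposite v
    rotate-opposite zero    v = trans (rotate-0 _) (cong opposite (rotate-0 v))
    rotate-opposite (suc m) v = begin
      rotate (suc m) (opposite (rotate (suc m) v))           ≡⟨ rotate-rotate 1 m _ ⟨
      rotate m (rotate 1 (opposite (rotate (suc m) v)))      ≡⟨ cong (λ k → rotate m (rotate 1 (opposite (rotate k v)))) (ℕ.+-comm 1 m) ⟩
      rotate m (rotate 1 (opposite (rotate (m +ℕ 1) v)))     ≡⟨ cong (rotate m ∘ rotate 1 ∘ opposite) (rotate-rotate m 1 v) ⟨
      rotate m (rotate 1 (opposite (rotate 1 (rotate m v)))) ≡⟨ cong (rotate m) (rotate-1-opposite (rotate m v)) ⟩
      rotate m (opposite (rotate m v))                       ≡⟨ rotate-opposite m v ⟩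
      opposite v                                             ∎

    reverse-automorphism : IsAutomorphism (cycle n) reverse
    reverse-automorphism v w = mk⇔ (Sum.swap ∘ Sum.map step step) (Sum.swap ∘ Sum.map back back)
      where
      step : ∀ {v w} → w ≡ rotate 1 v → opposite v ≡ rotate 1 (opposite w)
      step {v} refl = sym (rotate-1-opposite v)
      back : ∀ {v w} → opposite w ≡ rotate 1 (opposite v) → v ≡ rotate 1 w
      back {v} {w} eq = trans (sym (opposite-involutive v))
        (trans (step eq) (cong (rotate 1) (opposite-involutive w)))

    -- Along the orbit 0, 1, 2, … of rotate 1 an automorphism moves by one step
    -- at a time and cannot turn back, hence it always moves in the same direction.
    cycle-automorphism : 3 ≤ n → ∀ {π} → IsAutomorphism (cycle n) π →
      ∃ λ (m : Fin n) → (∀ v → π ⟨$⟩ʳ v ≡ rotate (toℕ m) v)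
                      ⊎ (∀ v → π ⟨$⟩ʳ v ≡ opposite (rotate (toℕ m) v))
    cycle-automorphism 3≤n {π} aut = go (adjacent 0)
      where
      origin : Fin n
      origin = fromℕ< (ℕ.≤-trans (s≤s z≤n) 3≤n)
      p : ℕ → Fin n
      p i = π ⟨$⟩ʳ rotate i origin
      rotate-toℕ-origin : ∀ (v : Fin n) → rotate (toℕ v) origin ≡ v
      rotate-toℕ-origin v = trans (rotate-toℕ-comm v origin)
        (trans (cong (λ k → rotate k v) (toℕ-fromℕ< _)) (rotate-0 v))
      rotate-suc : ∀ i (v : Fin n) → rotate (suc i) v ≡ rotate 1 (rotate i v)
      rotate-suc i v = trans (cong (λ k → rotate k v) (ℕ.+-comm 1 i)) (sym (rotate-rotate i 1 v))
      π≡p : ∀ v → π ⟨$⟩ʳ v ≡ p (toℕ v)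
      π≡p v = cong (π ⟨$⟩ʳ_) (sym (rotate-toℕ-origin v))
      adjacent : ∀ i → p (suc i) ≡ rotate 1 (p i) ⊎ p i ≡ rotate 1 (p (suc i))
      adjacent i = Equivalence.to (aut _ _) (inj₁ (rotate-suc i origin))
      no-return : ∀ i → p (suc (suc i)) ≢ p i
      no-return i eq = rotate-2-fixpoint-free 3≤n (rotate i origin) (begin
        rotate 1 (rotate 1 (rotate i origin)) ≡⟨ cong (rotate 1) (rotate-suc i origin) ⟨
        rotate 1 (rotate (suc i) origin)      ≡⟨ rotate-suc (suc i) origin ⟨
        rotate (suc (suc i)) origin           ≡⟨ inverseˡ π ⟨
        π ⟨$⟩ˡ p (suc (suc i))                ≡⟨ cong (π ⟨$⟩ˡ_) eq ⟩
        π ⟨$⟩ˡ p i                            ≡⟨ inverseˡ π ⟩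
        rotate i origin                       ∎)
      forward : p 1 ≡ rotate 1 (p 0) → ∀ i → p (suc i) ≡ rotate 1 (p i)
      forward eq zero    = eq
      forward eq (suc i) with adjacent (suc i)
      ... | inj₁ eq′ = eq′
      ... | inj₂ eq′ = contradiction
        (rotate-injective 1 (sym (trans (sym (forward eq i)) eq′))) (no-return i)
      backward : p 0 ≡ rotate 1 (p 1) → ∀ i → p i ≡ rotate 1 (p (suc i))
      backward eq zero    = eq
      backward eq (suc i) with adjacent (suc i)
      ... | inj₂ eq′ = eq′
      ... | inj₁ eq′ = contradiction (trans eq′ (sym (backward eq i))) (no-return i)
      forward* : p 1 ≡ rotate 1 (p 0) → ∀ i → p i ≡ rotate i (p 0)
      forward* eq zero    = sym (rotate-0 (p 0))
      forward* eq (suc i) = trans (forward eq i)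
        (trans (cong (rotate 1) (forward* eq i)) (sym (rotate-suc i (p 0))))
      backward* : p 0 ≡ rotate 1 (p 1) → ∀ i → p 0 ≡ rotate i (p i)
      backward* eq zero    = sym (rotate-0 (p 0))
      backward* eq (suc i) = trans (backward* eq i)
        (trans (cong (rotate i) (backward eq i)) (rotate-rotate 1 i _))
      go : p 1 ≡ rotate 1 (p 0) ⊎ p 0 ≡ rotate 1 (p 1) → _
      go (inj₁ eq) = p 0 , inj₁ λ v → trans (π≡p v)
        (trans (forward* eq (toℕ v)) (rotate-toℕ-comm v (p 0)))
      -- The index is forced by the vertex 0, which `opposite ∘ rotate m` sends to `opposite m`;
      -- this has to be `p 0`.
      go (inj₂ eq) = opposite (p 0) , inj₂ λ v → let i = toℕ v in begin
        π ⟨$⟩ʳ v                                          ≡⟨ π≡p v ⟩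
        p i                                               ≡⟨ opposite-involutive (p i) ⟨
        opposite (opposite (p i))                         ≡⟨ cong opposite (rotate-opposite i (p i)) ⟨
        opposite (rotate i (opposite (rotate i (p i))))   ≡⟨ cong (opposite ∘ rotate i ∘ opposite) (backward* eq i) ⟨
        opposite (rotate i (opposite (p 0)))              ≡⟨ cong opposite (rotate-toℕ-comm v (opposite (p 0))) ⟩
        opposite (rotate (toℕ (opposite (p 0))) v)        ∎

-- The dihedral action on colorings and its orbit counts

module _ (Γ : Graph) (ℓ μ : ℕ) where

  act : (π : Permutation′ (order Γ)) → IsAutomorphism Γ π → ProperColoring Γ ℓ μ → ProperColoring Γ ℓ μ
  act π aut (f , p) = f ∘ (π ⟨$⟩ʳ_) , λ v w → p _ _ ∘ Equivalence.to (aut v w)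

  act-inverse : (π : Permutation′ (order Γ)) → IsAutomorphism Γ π →
                Inverse (DecSetoid.setoid (coloringDecSetoid Γ ℓ μ)) (DecSetoid.setoid (coloringDecSetoid Γ ℓ μ))
  act-inverse π aut = record
    { to        = act π aut
    ; from      = act (flip π) (Subgroup.flip∈ (Aut Γ) {π} aut)
    ; to-cong   = λ eq v → eq (π ⟨$⟩ʳ v)
    ; from-cong = λ eq v → eq (π ⟨$⟩ˡ v)
    ; inverse   = (λ {x} eq v → trans (cong (proj₁ x) (sym (inverseˡ π))) (eq (π ⟨$⟩ʳ v)))
                , (λ {x} eq v → trans (cong (proj₁ x) (sym (inverseʳ π))) (eq (π ⟨$⟩ˡ v)))
    }

module _ (n : ℕ) .{{_ : NonZero n}} (3≤n : 3 ≤ n) (ℓ μ : ℕ) where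

  private
    Γ = cycle n
    X = colorings-finite Γ ℓ μ
    open DecSetoid (coloringDecSetoid Γ ℓ μ) using (Carrier; _≈_)
      renaming (_≟_ to _≈?_; refl to ≈-refl; sym to ≈-sym; trans to ≈-trans)

    rotation-aut : ∀ m → IsAutomorphism Γ (rotation m)
    rotation-aut m = rotation-automorphism {π = rotation m} (rotation-isRotation m)

    r : ℕ → Carrier → Carrier
    r m = act Γ ℓ μ (rotation m) (rotation-aut m)

    s : Carrier → Carrier
    s = act Γ ℓ μ reverse reverse-automorphism

    s-involutive : ∀ x → s (s x) ≈ x
    s-involutive (f , _) v = cong f (sym (opposite-involutive v))

    G : Carrier → Carrier → ℕ
    G y x = ∑[ m < n ] χ (r (toℕ m) y ≈? x)

    G-cong : ∀ y y′ x → y ≈ y′ → G y x ≡ G y′ x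
    G-cong y y′ x eq = sum-cong-≗ {n} λ m → χ-cong (r (toℕ m) y ≈? x) (r (toℕ m) y′ ≈? x)
      (λ p v → trans (p v) (sym (eq _))) (λ p v → trans (p v) (eq _))

    -- The substitution of m + a mod n for `m` permutes the indices of the sum.
    G-rotate : ∀ a y x → G (r a y) x ≡ G y x
    G-rotate a y@(f , _) x = sym (trans (sum-permute {n} {n} (λ m → χ (r (toℕ m) y ≈? x)) (rotation a))
      (sum-cong-≗ {n} λ m → χ-cong (r (toℕ (rotate a m)) y ≈? x) (r (toℕ m) (r a y) ≈? x)
        (λ p v → trans (p v) (cong f (eq m v))) (λ p v → trans (p v) (cong f (sym (eq m v))))))
      where
      eq : ∀ (m v : Fin n) → rotate (toℕ (rotate a m)) v ≡ rotate a (rotate (toℕ m) v)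
      eq m v = trans (rotate-mod (toℕ m +ℕ a) v) (sym (rotate-rotate (toℕ m) a v))

    G-total : ∀ y → ∑ₛ X (G y) ≡ n
    G-total y = begin
      ∑ₛ X (G y)                                         ≡⟨ ∑-comm {_} {n} (λ i m → χ (r (toℕ m) y ≈? element X i)) ⟩
      ∑[ m < n ] ∑ₛ X (λ x → χ (r (toℕ m) y ≈? x))       ≡⟨ sum-cong-≗ {n} (λ m → ∑ₛ-≈ (coloringDecSetoid Γ ℓ μ) X (r (toℕ m) y)) ⟩
      ∑[ m < n ] 1                                       ≡⟨ sum-const n 1 ⟩
      n *ℕ 1                                             ≡⟨ ℕ.*-identityʳ n ⟩
      n                                                  ∎

    G-support : ∀ y x → (∀ m → ¬ r m y ≈ x) → G y x ≡ 0
    G-support y x ¬≈ = sum-zero {n} λ m → χ-false (r (toℕ m) y ≈? x) (¬≈ (toℕ m))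

    D : Carrier → Carrier → ℕ
    D y x = G y x +ℕ G (s y) x

    D-reflect : ∀ y x → D (s y) x ≡ D y x
    D-reflect y x = trans (cong (G (s y) x +ℕ_) (G-cong (s (s y)) y x (s-involutive y))) (ℕ.+-comm (G (s y) x) (G y x))

    -- In the reflected summand the rotation by `a` appears inverted behind `s`. A further rotation
    -- by `a`, which `G` does not notice, cancels it.
    D-rotate : ∀ a y x → D (r a y) x ≡ D y x
    D-rotate a y@(f , _) x = cong₂ _+ℕ_ (G-rotate a y x) (begin
      G (s (r a y)) x        ≡⟨ G-rotate a (s (r a y)) x ⟨
      G (r a (s (r a y))) x  ≡⟨ G-cong (r a (s (r a y))) (s y) x (λ v → cong f (sym (rotate-opposite a v))) ⟩
      G (s y) x              ∎)

    D-cong : ∀ y y′ x → y ≈ y′ → D y x ≡ D y′ x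
    D-cong y y′ x eq = cong₂ _+ℕ_ (G-cong y y′ x eq) (G-cong (s y) (s y′) x λ v → eq (opposite v))

  -- Index `m` belongs to the reflection v ↦ -1 - m - v mod n. Index 0 thus flips the edge between
  -- n-1 and 0, whereas index 1 fixes the vertex n-1.
  reflectionFixed : ℕ → ℕ
  reflectionFixed m = ∑ₛ X (λ x → χ (r m (s x) ≈? x))

  burnside-Rot : ∑ₛ X (λ x → G x x) ≡ OP Γ (Rot n) ℓ μ *ℕ n
  burnside-Rot = burnside X (orbits-finite Γ (Rot n) ℓ μ) G n
    (λ { {y} {y′} x (g , (m , eq) , y′≡) →
         trans (sym (G-rotate (toℕ m) y x)) (G-cong (r (toℕ m) y) y′ x λ v → trans (y′≡ v) (cong (proj₁ y) (eq v))) })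
    (λ {y} {x} ¬∼ → G-support y x λ m eq → ¬∼ (rotation m , rotation-isRotation m , eq))
    G-total

  burnside-Aut : ∑ₛ X (λ x → D x x) ≡ OP Γ (Aut Γ) ℓ μ *ℕ (n +ℕ n)
  burnside-Aut = burnside X (orbits-finite Γ (Aut Γ) ℓ μ) D (n +ℕ n)
    (λ {y} {y′} → D-invariant {y} {y′})
    (λ {y} {x} ¬∼ → cong₂ _+ℕ_
      (G-support y x λ m eq → ¬∼ (rotation m , rotation-aut m , eq))
      -- `∘ₚ` applies its left factor first, so this permutation is v ↦ `opposite (rotate m v)`, by
      -- which `r m (s y)` precomposes.
      (G-support (s y) x λ m eq → ¬∼ (rotation m ∘ₚ reverse
        , Subgroup.∘∈ (Aut Γ) {rotation m} {reverse} (rotation-aut m) reverse-automorphism , eq)))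
    (λ y → trans (∑-distrib-+ (G y ∘ element X) (G (s y) ∘ element X)) (cong₂ _+ℕ_ (G-total y) (G-total (s y))))
    where
    D-invariant : ∀ {y y′} x → _∼_ Γ (Aut Γ) ℓ μ y y′ → D y x ≡ D y′ x
    D-invariant {y} {y′} x (g , aut , y′≡) with cycle-automorphism 3≤n {g} aut
    ... | m , inj₁ eq = trans (sym (D-rotate (toℕ m) y x))
      (D-cong (r (toℕ m) y) y′ x λ v → trans (y′≡ v) (cong (proj₁ y) (eq v)))
    ... | m , inj₂ eq = trans (sym (trans (D-rotate (toℕ m) (s y) x) (D-reflect y x)))
      (D-cong (r (toℕ m) (s y)) y′ x λ v → trans (y′≡ v) (cong (proj₁ y) (eq v)))

  Aut-Rot-orbits : OP Γ (Aut Γ) ℓ μ *ℕ (n +ℕ n) ≡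
                   OP Γ (Rot n) ℓ μ *ℕ n +ℕ ∑[ m < n ] reflectionFixed (toℕ m)
  Aut-Rot-orbits = begin
    OP Γ (Aut Γ) ℓ μ *ℕ (n +ℕ n)                           ≡⟨ burnside-Aut ⟨
    ∑ₛ X (λ x → D x x)                                     ≡⟨ ∑-distrib-+ (λ i → G (element X i) (element X i)) _ ⟩
    ∑ₛ X (λ x → G x x) +ℕ ∑ₛ X (λ x → G (s x) x)           ≡⟨ cong₂ _+ℕ_ burnside-Rot (∑-comm {_} {n} (λ i m → χ (r (toℕ m) (s (element X i)) ≈? element X i))) ⟩
    OP Γ (Rot n) ℓ μ *ℕ n +ℕ ∑[ m < n ] reflectionFixed (toℕ m) ∎

  reflectionFixed-rotate : ∀ {a b} → (∀ (v : Fin n) → rotate a v ≡ rotate b v) →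
                           reflectionFixed a ≡ reflectionFixed b
  reflectionFixed-rotate {a} {b} eq = sum-cong-≗ λ i → let x = element X i in
    χ-cong (r a (s x) ≈? x) (r b (s x) ≈? x)
      (λ p v → trans (p v) (cong (proj₁ x ∘ opposite) (eq v)))
      (λ p v → trans (p v) (cong (proj₁ x ∘ opposite) (sym (eq v))))

  -- The reflections with indices m and 2 + m are conjugate under rotation 1.
  reflectionFixed-2+ : ∀ m → reflectionFixed (2 +ℕ m) ≡ reflectionFixed m
  reflectionFixed-2+ m = trans
    (sym (∑ₛ-permute X (act-inverse Γ ℓ μ (rotation 1) (rotation-aut 1)) (λ x → χ (r (2 +ℕ m) (s x) ≈? x))
      λ {x} {y} eq → χ-cong (r (2 +ℕ m) (s x) ≈? x) (r (2 +ℕ m) (s y) ≈? y)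
        (λ p v → trans (eq v) (trans (p v) (sym (eq _))))
        (λ p v → trans (sym (eq v)) (trans (p v) (eq _)))))
    (sum-cong-≗ (λ i → conj (element X i)))
    where
    -- Of the two additional steps, one cancels against the outer rotation by the dihedral relation,
    -- and the other remains at `v`.
    rotate-1-opposite-2+ : ∀ (v : Fin n) → rotate 1 (opposite (rotate (2 +ℕ m) v)) ≡ opposite (rotate m (rotate 1 v))
    rotate-1-opposite-2+ v = begin
      rotate 1 (opposite (rotate (2 +ℕ m) v))              ≡⟨ cong (λ k → rotate 1 (opposite (rotate (suc k) v))) (ℕ.+-comm 1 m) ⟩
      rotate 1 (opposite (rotate (1 +ℕ (m +ℕ 1)) v))       ≡⟨ cong (rotate 1 ∘ opposite) (rotate-rotate 1 (m +ℕ 1) v) ⟨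
      rotate 1 (opposite (rotate (m +ℕ 1) (rotate 1 v)))   ≡⟨ cong (rotate 1 ∘ opposite) (rotate-rotate m 1 (rotate 1 v)) ⟨
      rotate 1 (opposite (rotate 1 (rotate m (rotate 1 v)))) ≡⟨ rotate-1-opposite (rotate m (rotate 1 v)) ⟩
      opposite (rotate m (rotate 1 v))                     ∎
    conj : ∀ x → χ (r (2 +ℕ m) (s (r 1 x)) ≈? r 1 x) ≡ χ (r m (s x) ≈? x)
    conj x@(f , _) = χ-cong (r (2 +ℕ m) (s (r 1 x)) ≈? r 1 x) (r m (s x) ≈? x)
      (λ p v → let w = rotation 1 ⟨$⟩ˡ v in begin
        f v                                       ≡⟨ cong f (inverseʳ (rotation 1)) ⟨
        f (rotate 1 w)                            ≡⟨ p w ⟩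
        f (rotate 1 (opposite (rotate (2 +ℕ m) w))) ≡⟨ cong f (rotate-1-opposite-2+ w) ⟩
        f (opposite (rotate m (rotate 1 w)))      ≡⟨ cong (f ∘ opposite ∘ rotate m) (inverseʳ (rotation 1)) ⟩
        f (opposite (rotate m v))                 ∎)
      (λ p v → trans (p (rotate 1 v)) (cong f (sym (rotate-1-opposite-2+ v))))

  reflectionFixed-size : ∀ m {T : Setoid 0ℓ 0ℓ} (F : Finite T) (e : Setoid.Carrier T → Carrier) →
    (∀ {t u} → e t ≈ e u → Setoid._≈_ T t u) → (∀ {t u} → Setoid._≈_ T t u → e t ≈ e u) →
    (∀ t v → proj₁ (e t) v ≡ proj₁ (e t) (opposite (rotate m v))) →
    (∀ {x} → (∀ v → proj₁ x v ≡ proj₁ x (opposite (rotate m v))) → ∃ λ t → e t ≈ x) →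
    reflectionFixed m ≡ Finite.size F
  reflectionFixed-size m F e e-injective e-cong e-fixed e-onto =
    ∑ₛ-image (coloringDecSetoid Γ ℓ μ) X F e e-injective e-cong (λ x → r m (s x) ≈? x)
      (λ t eq v → trans (eq v) (trans (e-fixed t v) (sym (eq _)))) (λ {x} → e-onto {x})

-- Summing the fixed colorings over all reflections

sum-2-periodic : ∀ {n} q (F : ℕ → ℕ) → n ≡ q *ℕ 2 → (∀ m → F (2 +ℕ m) ≡ F m) →
                 ∑[ m < n ] F (toℕ m) ≡ q *ℕ (F 0 +ℕ F 1)
sum-2-periodic zero    F refl periodic = refl
sum-2-periodic (suc q) F refl periodic = begin
  F 0 +ℕ (F 1 +ℕ ∑[ m < q *ℕ 2 ] F (2 +ℕ toℕ m))   ≡⟨ ℕ.+-assoc (F 0) (F 1) _ ⟨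
  F 0 +ℕ F 1 +ℕ ∑[ m < q *ℕ 2 ] F (2 +ℕ toℕ m)     ≡⟨ cong (F 0 +ℕ F 1 +ℕ_) (sum-cong-≗ {q *ℕ 2} (periodic ∘ toℕ)) ⟩
  F 0 +ℕ F 1 +ℕ ∑[ m < q *ℕ 2 ] F (toℕ m)          ≡⟨ cong (F 0 +ℕ F 1 +ℕ_) (sum-2-periodic q F refl periodic) ⟩
  F 0 +ℕ F 1 +ℕ q *ℕ (F 0 +ℕ F 1)                  ∎

2-periodic-odd : ∀ k (F : ℕ → ℕ) → (∀ m → F (2 +ℕ m) ≡ F m) → F (suc (k *ℕ 2)) ≡ F 1
2-periodic-odd zero    F periodic = refl
2-periodic-odd (suc k) F periodic = trans (periodic _) (2-periodic-odd k F periodic)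

2-periodic-const : (F : ℕ → ℕ) → (∀ m → F (2 +ℕ m) ≡ F m) → F 1 ≡ F 0 → ∀ m → F m ≡ F 0
2-periodic-const F periodic eq zero          = refl
2-periodic-const F periodic eq (suc zero)    = eq
2-periodic-const F periodic eq (suc (suc m)) = trans (periodic m) (2-periodic-const F periodic eq m)

-- For odd `n`, periodicity carries `F n` down to `F 1`; hence `F n ≡ F 0` links the two parity
-- classes and `F` is constant.
sum-periodic-odd : ∀ {n} k (F : ℕ → ℕ) → n ≡ suc (k *ℕ 2) → (∀ m → F (2 +ℕ m) ≡ F m) → F n ≡ F 0 →
                   ∑[ m < n ] F (toℕ m) ≡ n *ℕ F 0
sum-periodic-odd {n} k F refl periodic F[n]≡F[0] = trans
  (sum-cong-≗ {n} (2-periodic-const F periodic (trans (sym (2-periodic-odd k F periodic)) F[n]≡F[0]) ∘ toℕ))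
  (sum-const n (F 0))

module _ (n : ℕ) .{{_ : NonZero n}} (3≤n : 3 ≤ n) (ℓ μ : ℕ) where

  private
    A B : ℕ
    A = OP (cycle n) (Aut (cycle n)) ℓ μ
    B = OP (cycle n) (Rot n) ℓ μ

    R : ℕ → ℕ
    R = reflectionFixed n 3≤n ℓ μ

    open ℕ-Solver

  odd-orbits : ∀ k → n ≡ suc (k *ℕ 2) → A *ℕ 2 ≡ B +ℕ R 0
  odd-orbits k n≡ = ℕ.*-cancelʳ-≡ _ _ n (begin
    A *ℕ 2 *ℕ n                       ≡⟨ solve 2 (λ a n → a :* con 2 :* n := a :* (n :+ n)) refl A n ⟩
    A *ℕ (n +ℕ n)                     ≡⟨ Aut-Rot-orbits n 3≤n ℓ μ ⟩
    B *ℕ n +ℕ ∑[ m < n ] R (toℕ m)    ≡⟨ cong (B *ℕ n +ℕ_) (sum-periodic-odd k R n≡ (reflectionFixed-2+ n 3≤n ℓ μ)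
                                           (reflectionFixed-rotate n 3≤n ℓ μ (rotate-+n 0))) ⟩
    B *ℕ n +ℕ n *ℕ R 0                ≡⟨ solve 3 (λ b n r → b :* n :+ n :* r := (b :+ r) :* n) refl B n (R 0) ⟩
    (B +ℕ R 0) *ℕ n                   ∎)

  -- The two classes have q = n/2 reflections each. Doubling the orbit equation turns this weight
  -- into `n`, which then cancels throughout.
  even-orbits : ∀ q → n ≡ q *ℕ 2 → A *ℕ 4 ≡ B *ℕ 2 +ℕ (R 0 +ℕ R 1)
  even-orbits q n≡ = ℕ.*-cancelʳ-≡ _ _ n (begin
    A *ℕ 4 *ℕ n                              ≡⟨ solve 2 (λ a n → a :* con 4 :* n := a :* (n :+ n) :* con 2) refl A n ⟩
    A *ℕ (n +ℕ n) *ℕ 2                       ≡⟨ cong (_*ℕ 2) (Aut-Rot-orbits n 3≤n ℓ μ) ⟩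
    (B *ℕ n +ℕ ∑[ m < n ] R (toℕ m)) *ℕ 2    ≡⟨ cong (λ t → (B *ℕ n +ℕ t) *ℕ 2) (sum-2-periodic q R n≡ (reflectionFixed-2+ n 3≤n ℓ μ)) ⟩
    (B *ℕ n +ℕ q *ℕ (R 0 +ℕ R 1)) *ℕ 2       ≡⟨ solve 4 (λ b n q r → (b :* n :+ q :* r) :* con 2 := b :* con 2 :* n :+ r :* (q :* con 2))
                                                  refl B n q (R 0 +ℕ R 1) ⟩
    B *ℕ 2 *ℕ n +ℕ (R 0 +ℕ R 1) *ℕ (q *ℕ 2)  ≡⟨ cong (λ k → B *ℕ 2 *ℕ n +ℕ (R 0 +ℕ R 1) *ℕ k) n≡ ⟨
    B *ℕ 2 *ℕ n +ℕ (R 0 +ℕ R 1) *ℕ n         ≡⟨ ℕ.*-distribʳ-+ n (B *ℕ 2) (R 0 +ℕ R 1) ⟨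
    (B *ℕ 2 +ℕ (R 0 +ℕ R 1)) *ℕ n            ∎)

-- Deleting a looped vertex

↑ʳ-reduce≥ : ∀ m {d} (c : Fin (m +ℕ d)) (m≤c : m ≤ toℕ c) → m ↑ʳ reduce≥ c m≤c ≡ c
↑ʳ-reduce≥ zero    c       m≤c = refl
↑ʳ-reduce≥ (suc m) (suc c) m≤c = cong suc (↑ʳ-reduce≥ m c (s≤s⁻¹ m≤c))

-- `π` lists the vertices of `Γ` with the looped one in front. Taking it as a parameter lets one
-- lemma delete either end of a path. `d` is the number of colors above `μ`.
module _ (Γ Δ : Graph) (π : Permutation (suc (order Δ)) (order Γ))
         (loop : Adj Γ (π ⟨$⟩ʳ zero) (π ⟨$⟩ʳ zero))
         (adj⇔ : ∀ i j → Adj Δ i j ⇔ Adj Γ (π ⟨$⟩ʳ suc i) (π ⟨$⟩ʳ suc j))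
         (μ d : ℕ) where

  private
    ℓ : ℕ
    ℓ = μ +ℕ d
    S = DecSetoid.setoid (coloringDecSetoid Γ ℓ μ)
    T = DecSetoid.setoid (coloringDecSetoid Δ ℓ μ)

    -- A loop makes the vertex adjacent to itself, which leaves only the second alternative of
    -- properness. Colors are numbered from 1, so μ < color bounds the underlying element of `Fin ℓ`
    -- below by `μ` itself.
    μ≤looped : ∀ (x : ProperColoring Γ ℓ μ) → μ ≤ toℕ (proj₁ x (π ⟨$⟩ʳ zero))
    μ≤looped (f , p) with p _ _ loop
    ... | inj₁ ≢       = contradiction refl ≢
    ... | inj₂ (_ , lt) = s≤s⁻¹ lt

    extend : Fin d → Coloring Δ ℓ → Fin (suc (order Δ)) → Fin ℓ
    extend c g zero    = μ ↑ʳ c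
    extend c g (suc i) = g i

    μ<high : ∀ (c : Fin d) → μ < color (μ ↑ʳ c)
    μ<high c = s≤s (ℕ.≤-trans (ℕ.m≤m+n μ (toℕ c)) (ℕ.≤-reflexive (sym (toℕ-↑ʳ μ c))))

    extend-proper : ∀ c (y : ProperColoring Δ ℓ μ) i j → Adj Γ (π ⟨$⟩ʳ i) (π ⟨$⟩ʳ j) →
      let f = extend c (proj₁ y) in f i ≢ f j ⊎ (f i ≡ f j × μ < color (f i))
    extend-proper c (g , q) (suc i) (suc j) a = q i j (Equivalence.from (adj⇔ i j) a)
    extend-proper c (g , q) zero    j       a with (μ ↑ʳ c) ≟ extend c g j
    ... | yes eq = inj₂ (eq , μ<high c)
    ... | no  ≢  = inj₁ ≢
    extend-proper c (g , q) (suc i) zero    a with g i ≟ (μ ↑ʳ c)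
    ... | yes eq = inj₂ (eq , ≡.subst (λ c → μ < color c) (sym eq) (μ<high c))
    ... | no  ≢  = inj₁ ≢

    to : ProperColoring Γ ℓ μ → Fin d × ProperColoring Δ ℓ μ
    to x@(f , p) = reduce≥ (f (π ⟨$⟩ʳ zero)) (μ≤looped x)
                 , (λ i → f (π ⟨$⟩ʳ suc i)) , λ i j → p _ _ ∘ Equivalence.to (adj⇔ i j)

    high-to : ∀ x → μ ↑ʳ proj₁ (to x) ≡ proj₁ x (π ⟨$⟩ʳ zero)
    high-to x@(f , _) = ↑ʳ-reduce≥ μ (f (π ⟨$⟩ʳ zero)) (μ≤looped x)

    from : Fin d × ProperColoring Δ ℓ μ → ProperColoring Γ ℓ μ
    from (c , y) = (λ v → extend c (proj₁ y) (π ⟨$⟩ˡ v)) , λ v w a →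
      extend-proper c y (π ⟨$⟩ˡ v) (π ⟨$⟩ˡ w) (≡.subst₂ (Adj Γ) (sym (inverseʳ π)) (sym (inverseʳ π)) a)

    S↔d×T : Inverse S (≡.setoid (Fin d) ×ₛ T)
    S↔d×T = record
      { to        = to
      ; from      = from
      ; to-cong   = λ {x} {y} eq →
          ↑ʳ-injective μ _ _ (trans (high-to x) (trans (sym (eq _)) (sym (high-to y))))
        , λ i → eq _
      ; from-cong = λ { {x} {y} (refl , eq) v → extend-cong {x} {y} eq (π ⟨$⟩ˡ v) }
      ; inverse   = (λ {x} {y} eq →
                        ↑ʳ-injective μ _ _ (trans (high-to y) (trans (sym (eq _)) (cong (extend _ _) (inverseˡ π))))
                      , λ i → trans (sym (cong (extend _ _) (inverseˡ π))) (eq _))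
                  , (λ {x} {y} eq v → trans (cong (proj₁ x) (sym (inverseʳ π))) (extend-to {x} {y} eq (π ⟨$⟩ˡ v)))
      }
      where
      extend-cong : ∀ {x y : Fin d × ProperColoring Δ ℓ μ} → (∀ i → proj₁ (proj₂ y) i ≡ proj₁ (proj₂ x) i) →
        ∀ i → extend (proj₁ x) (proj₁ (proj₂ y)) i ≡ extend (proj₁ x) (proj₁ (proj₂ x)) i
      extend-cong eq zero    = refl
      extend-cong eq (suc i) = eq i
      extend-to : ∀ {x y} → Setoid._≈_ (≡.setoid (Fin d) ×ₛ T) y (to x) →
        ∀ i → proj₁ x (π ⟨$⟩ʳ i) ≡ extend (proj₁ y) (proj₁ (proj₂ y)) i
      extend-to {x} (refl , eq) zero    = sym (high-to x)
      extend-to     (_ , eq)    (suc i) = eq i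

  -- A vertex with a loop carries a color > μ, and then no edge at it is a constraint.
  P-delete-loop : P Γ ℓ μ ≡ d *ℕ P Δ ℓ μ
  P-delete-loop = ↔⇒≡ (Inv.trans (enumeration (colorings-finite Γ ℓ μ)) (Inv.trans S↔d×T (Inv.trans
    (Inv.refl (≡.setoid (Fin d)) ×-inverse Inv.sym (enumeration (colorings-finite Δ ℓ μ)))
    (Inv.trans Pointwise-≡↔≡ (Inv.sym *↔×)))))

-- Fixed colorings as colorings of a quotient graph

module _ (n : ℕ) .{{_ : NonZero n}} (3≤n : 3 ≤ n) (m : ℕ)
         (Q : Graph) (h : Fin n → Vertex Q) (e : Vertex Q → Fin n)
         (h∘e : ∀ u → h (e u) ≡ u) (h-fixed : ∀ v → h (opposite (rotate m v)) ≡ h v)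
         (e∘h : ∀ v → e (h v) ≡ v ⊎ e (h v) ≡ opposite (rotate m v))
         (h-adj : ∀ v → Adj Q (h v) (h (rotate 1 v)))
         (lift-adj : ∀ {u u′} → Adj Q u u′ → ∃ λ v → ∃ λ w → h v ≡ u × h w ≡ u′ × Adj (cycle n) v w)
         (ℓ μ : ℕ) where

  -- `h` is the projection to the orbits and `e` chooses representatives, so composition with `h`
  -- has composition with `e` as its inverse on fixed colorings. Properness descends because each
  -- edge of `Q` lies below some edge of the cycle. That edge need not join chosen representatives:
  -- a loop comes from an edge between the two vertices of one orbit.
  reflectionFixed-quotient : reflectionFixed n 3≤n ℓ μ m ≡ P Q ℓ μ
  reflectionFixed-quotient = reflectionFixed-size n 3≤n ℓ μ m (colorings-finite Q ℓ μ) pullback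
    (λ {t} {u} eq v → trans (cong (proj₁ u) (sym (h∘e v))) (trans (eq (e v)) (cong (proj₁ t) (h∘e v))))
    (λ eq v → eq (h v))
    (λ t v → cong (proj₁ t) (sym (h-fixed v)))
    (λ {x} fixed → (proj₁ x ∘ e , descend-proper x fixed) , λ v → sym (descend x fixed v))
    where
    σ : Fin n → Fin n
    σ v = opposite (rotate m v)
    h-adj′ : ∀ {v w} → Adj (cycle n) v w → Adj Q (h v) (h w)
    h-adj′ (inj₁ refl) = h-adj _
    h-adj′ (inj₂ refl) = adj-sym Q (h-adj _)
    pullback : ProperColoring Q ℓ μ → ProperColoring (cycle n) ℓ μ
    pullback (g , q) = g ∘ h , λ v w a → q _ _ (h-adj′ a)
    descend : ∀ (x : ProperColoring (cycle n) ℓ μ) → (∀ v → proj₁ x v ≡ proj₁ x (σ v)) →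
              ∀ v → proj₁ x (e (h v)) ≡ proj₁ x v
    descend (f , _) fixed v with e∘h v
    ... | inj₁ eq = cong f eq
    ... | inj₂ eq = trans (cong f eq) (sym (fixed v))
    descend-proper : ∀ (x : ProperColoring (cycle n) ℓ μ) → (∀ v → proj₁ x v ≡ proj₁ x (σ v)) →
                     Proper Q ℓ μ (proj₁ x ∘ e)
    descend-proper x@(f , p) fixed u u′ a with lift-adj a
    ... | v , w , refl , refl , a′ rewrite descend x fixed v | descend x fixed w = p v w a′

-- The quotient by the reversal

loopedPath : (k : ℕ) (L : Fin k → Set) → (∀ v → Dec (L v)) → Graph
loopedPath k L L? = record
  { order   = k
  ; Adj     = λ v w → (toℕ w ≡ suc (toℕ v) ⊎ toℕ v ≡ suc (toℕ w)) ⊎ (v ≡ w × L v)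
  ; adj?    = λ v w → ((toℕ w ℕ.≟ suc (toℕ v)) ⊎-dec (toℕ v ℕ.≟ suc (toℕ w))) ⊎-dec ((v ≟ w) ×-dec L? v)
  ; adj-sym = λ { (inj₁ a) → inj₁ (Sum.swap a) ; (inj₂ (refl , l)) → inj₂ (refl , l) }
  }

-- The quotient of the cycle by v ↦ n - 1 - v: the vertex u of the path is
-- the orbit with smaller element u.
module _ (n : ℕ) (k : ℕ) where

  -- The reversal flips the edge between n-1 and 0, whose orbit is 0, and for even `n` also the edge
  -- between n/2 - 1 and n/2, whose orbit `u` satisfies 2u + 2 = n.
  EndLoop : Fin k → Set
  EndLoop u = toℕ u ≡ 0 ⊎ suc (suc (toℕ u +ℕ toℕ u)) ≡ n

  foldedCycle : Graph
  foldedCycle = loopedPath k EndLoop λ u → (toℕ u ℕ.≟ 0) ⊎-dec (suc (suc (toℕ u +ℕ toℕ u)) ℕ.≟ n)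

  -- `<k⇔` says that `k` is n/2 rounded up, the number of orbits, for both parities of `n` and
  -- without a division.
  module _ .{{_ : NonZero n}} (3≤n : 3 ≤ n) (<k⇔ : ∀ u → u < k ⇔ u +ℕ u < n) where

    private
      fold : Fin n → ℕ
      fold v = toℕ v ⊓ toℕ (opposite v)

      fold-< : ∀ v → fold v +ℕ fold v < n
      fold-< v = ℕ.≤-trans
        (ℕ.+-mono-≤-< (ℕ.m⊓n≤n (toℕ v) (toℕ (opposite v))) (s≤s (ℕ.m⊓n≤m (toℕ v) (toℕ (opposite v)))))
        (ℕ.≤-reflexive (opposite-sum v))

      h : Fin n → Fin k
      h v = fromℕ< (Equivalence.from (<k⇔ (fold v)) (fold-< v))

      toℕ-h : ∀ v → toℕ (h v) ≡ fold v
      toℕ-h v = toℕ-fromℕ< _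

      h-≡ : ∀ {v w} → fold v ≡ fold w → h v ≡ h w
      h-≡ eq = toℕ-injective (trans (toℕ-h _) (trans eq (sym (toℕ-h _))))

      double-< : ∀ (u : Fin k) → toℕ u +ℕ toℕ u < n
      double-< u = Equivalence.to (<k⇔ (toℕ u)) (toℕ<n u)

      e : Fin k → Fin n
      e u = fromℕ< (ℕ.≤-<-trans (ℕ.m≤m+n (toℕ u) (toℕ u)) (double-< u))

      toℕ-e : ∀ u → toℕ (e u) ≡ toℕ u
      toℕ-e u = toℕ-fromℕ< _

      opposite-e : ∀ u → toℕ (opposite (e u)) +ℕ suc (toℕ u) ≡ n
      opposite-e u = trans (cong (λ i → toℕ (opposite (e u)) +ℕ suc i) (sym (toℕ-e u))) (opposite-sum (e u))

      h∘e : ∀ u → h (e u) ≡ u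
      h∘e u = toℕ-injective (begin
        toℕ (h (e u))                      ≡⟨ toℕ-h (e u) ⟩
        toℕ (e u) ⊓ toℕ (opposite (e u))   ≡⟨ cong (_⊓ toℕ (opposite (e u))) (toℕ-e u) ⟩
        toℕ u ⊓ toℕ (opposite (e u))       ≡⟨ ℕ.m≤n⇒m⊓n≡m u≤ ⟩
        toℕ u                              ∎)
        where
        u≤ : toℕ u ≤ toℕ (opposite (e u))
        u≤ = ℕ.+-cancelʳ-≤ (suc (toℕ u)) _ _ (ℕ.≤-trans
          (ℕ.≤-reflexive (ℕ.+-suc (toℕ u) (toℕ u)))
          (ℕ.≤-trans (double-< u) (ℕ.≤-reflexive (sym (opposite-e u)))))

      h∘opposite : ∀ v → h (opposite v) ≡ h v
      h∘opposite v = h-≡ (trans (cong (λ w → toℕ (opposite v) ⊓ toℕ w) (opposite-involutive v))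
        (ℕ.⊓-comm (toℕ (opposite v)) (toℕ v)))

      e∘h : ∀ v → e (h v) ≡ v ⊎ e (h v) ≡ opposite v
      e∘h v = Sum.map toℕ-e∘h toℕ-e∘h (ℕ.⊓-sel (toℕ v) (toℕ (opposite v)))
        where
        toℕ-e∘h : ∀ {w} → fold v ≡ toℕ w → e (h v) ≡ w
        toℕ-e∘h eq = toℕ-injective (trans (toℕ-e (h v)) (trans (toℕ-h v) eq))

      h-adj : ∀ v → Adj foldedCycle (h v) (h (rotate 1 v))
      h-adj v with rotate-1-cases v
      ... | inj₂ (p , q) = inj₂ (h-≡ (trans fold-v (sym (cong (_⊓ toℕ (opposite (rotate 1 v))) q))) , inj₁ (trans (toℕ-h v) fold-v))
        where
        fold-v : fold v ≡ 0
        fold-v = trans (cong (toℕ v ⊓_) (trans (opposite-prop v) (trans (cong (n ∸_) p) (ℕ.n∸n≡0 n))))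
                       (ℕ.⊓-zeroʳ (toℕ v))
      -- Since `opposite v` is 1 + b, the edge leads from orbit min(a, b+1) to orbit min(a+1, b):
      -- one up before the middle, one down after it. For a = b it is the flipped middle edge, and n
      -- = 2a + 2.
      ... | inj₁ p = go (ℕ.<-cmp a b)
        where
        a = toℕ v
        b = toℕ (opposite (rotate 1 v))
        fold-v : fold v ≡ a ⊓ suc b
        fold-v = cong (a ⊓_) (opposite-suc-≡ p)
        fold-w : fold (rotate 1 v) ≡ suc a ⊓ b
        fold-w = cong (_⊓ b) p
        go : Tri (a < b) (a ≡ b) (b < a) → Adj foldedCycle (h v) (h (rotate 1 v))
        go (tri< a<b _ _) = inj₁ (inj₁ (begin
          toℕ (h (rotate 1 v))   ≡⟨ trans (toℕ-h _) fold-w ⟩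
          suc a ⊓ b              ≡⟨ ℕ.m≤n⇒m⊓n≡m a<b ⟩
          suc a                  ≡⟨ cong suc (ℕ.m≤n⇒m⊓n≡m (ℕ.m≤n⇒m≤1+n (ℕ.<⇒≤ a<b))) ⟨
          suc (a ⊓ suc b)        ≡⟨ cong suc (trans (toℕ-h v) fold-v) ⟨
          suc (toℕ (h v))        ∎))
        go (tri> _ _ b<a) = inj₁ (inj₂ (begin
          toℕ (h v)                    ≡⟨ trans (toℕ-h v) fold-v ⟩
          a ⊓ suc b                    ≡⟨ ℕ.m≥n⇒m⊓n≡n b<a ⟩
          suc b                        ≡⟨ cong suc (ℕ.m≥n⇒m⊓n≡n (ℕ.m≤n⇒m≤1+n (ℕ.<⇒≤ b<a))) ⟨
          suc (suc a ⊓ b)              ≡⟨ cong suc (trans (toℕ-h _) fold-w) ⟨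
          suc (toℕ (h (rotate 1 v)))   ∎))
        go (tri≈ _ a≡b _) = inj₂ (h-≡ (trans fold-v≡a (sym fold-w≡a)) , inj₂ (begin
          suc (suc (toℕ (h v) +ℕ toℕ (h v)))   ≡⟨ cong (λ i → suc (suc (i +ℕ i))) (trans (toℕ-h v) fold-v≡a) ⟩
          suc (suc (a +ℕ a))                   ≡⟨ trans (ℕ.+-suc a (suc a)) (cong suc (ℕ.+-suc a a)) ⟨
          a +ℕ suc (suc a)                     ≡⟨ cong₂ (λ i j → i +ℕ suc j) a≡b (sym p) ⟩
          b +ℕ suc (toℕ (rotate 1 v))          ≡⟨ opposite-sum (rotate 1 v) ⟩
          n                                    ∎))
          where
          fold-v≡a : fold v ≡ a
          fold-v≡a = trans fold-v (ℕ.m≤n⇒m⊓n≡m (ℕ.m≤n⇒m≤1+n (ℕ.≤-reflexive a≡b)))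
          fold-w≡a : fold (rotate 1 v) ≡ a
          fold-w≡a = trans fold-w (trans (ℕ.m≥n⇒m⊓n≡n (ℕ.m≤n⇒m≤1+n (ℕ.≤-reflexive (sym a≡b)))) (sym a≡b))

      lift-adj : ∀ {u u′} → Adj foldedCycle u u′ →
                 ∃ λ v → ∃ λ w → h v ≡ u × h w ≡ u′ × Adj (cycle n) v w
      lift-adj {u} {u′} (inj₁ (inj₁ p)) = e u , e u′ , h∘e u , h∘e u′ ,
        inj₁ (rotate-1-suc (trans (toℕ-e u′) (trans p (cong suc (sym (toℕ-e u))))))
      lift-adj {u} {u′} (inj₁ (inj₂ p)) = e u , e u′ , h∘e u , h∘e u′ ,
        inj₂ (rotate-1-suc (trans (toℕ-e u) (trans p (cong suc (sym (toℕ-e u′))))))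
      -- The loop at 0 lifts to the edge that wraps around from n-1 to 0, hence `opposite (e u)`
      -- comes first; the middle loop below lifts in the other order.
      lift-adj {u} (inj₂ (refl , inj₁ p)) =
        opposite (e u) , e u , trans (h∘opposite (e u)) (h∘e u) , h∘e u ,
        inj₁ (rotate-1-wrap (trans (ℕ.+-comm 1 _)
          (trans (cong (λ i → toℕ (opposite (e u)) +ℕ suc i) (sym p)) (opposite-e u))) (trans (toℕ-e u) p))
      lift-adj {u} (inj₂ (refl , inj₂ p)) =
        e u , opposite (e u) , h∘e u , trans (h∘opposite (e u)) (h∘e u) ,
        inj₁ (rotate-1-suc (ℕ.+-cancelʳ-≡ (suc (toℕ u)) _ _ (begin
          toℕ (opposite (e u)) +ℕ suc (toℕ u)   ≡⟨ opposite-e u ⟩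
          n                                     ≡⟨ p ⟨
          suc (suc (toℕ u +ℕ toℕ u))            ≡⟨ cong suc (ℕ.+-suc (toℕ u) (toℕ u)) ⟨
          suc (toℕ u) +ℕ suc (toℕ u)            ≡⟨ cong (λ i → suc i +ℕ suc (toℕ u)) (toℕ-e u) ⟨
          suc (toℕ (e u)) +ℕ suc (toℕ u)        ∎)))

    reflectionFixed-0 : ∀ ℓ μ → reflectionFixed n 3≤n ℓ μ 0 ≡ P foldedCycle ℓ μ
    reflectionFixed-0 = reflectionFixed-quotient n 3≤n 0 foldedCycle h e h∘e
      (λ v → trans (cong (h ∘ opposite) (rotate-0 v)) (h∘opposite v))
      (λ v → Sum.map₂ (λ eq → trans eq (cong opposite (sym (rotate-0 v)))) (e∘h v))
      h-adj lift-adj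

-- The quotient by a reflection through two vertices

m+m≡m*2 : ∀ m → m +ℕ m ≡ m *ℕ 2
m+m≡m*2 = solve 1 (λ m → m :+ m := m :* con 2) refl
  where open ℕ-Solver

m*2≢1+n*2 : ∀ m n → m *ℕ 2 ≢ suc (n *ℕ 2)
m*2≢1+n*2 m n eq = ℕ.even≢odd m n (trans (ℕ.*-comm 2 m) (trans eq (cong suc (ℕ.*-comm n 2))))

-- The quotient of the cycle by v ↦ 2c - v mod n, where n = 2c + 2: the vertex u of
-- the path is the orbit of the vertices at distance u from c.
module _ (n : ℕ) .{{_ : NonZero n}} (3≤n : 3 ≤ n) (c : ℕ) (n≡2c+2 : n ≡ suc c *ℕ 2) where

  private
    σ : Fin n → Fin n
    σ v = opposite (rotate 1 v)

    -- With the vertices running from 0 to 2c+1, this difference is already the distance around the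
    -- cycle. Its maximum c+1 occurs only at 2c+1, the second fixed vertex.
    dist : Fin n → ℕ
    dist v = ∣ toℕ v - c ∣

    dist-right : ∀ {v a} → toℕ v ≡ c +ℕ a → dist v ≡ a
    dist-right {v} {a} eq = trans (cong ∣_- c ∣ eq) (trans (ℕ.∣-∣-comm (c +ℕ a) c) (ℕ.∣m-m+n∣≡n c a))

    dist-left : ∀ {v a} → toℕ v +ℕ a ≡ c → dist v ≡ a
    dist-left {v} {a} eq = trans (cong ∣ toℕ v -_∣ (sym eq)) (ℕ.∣m-m+n∣≡n (toℕ v) a)

    side : ∀ (v : Fin n) → (∃ λ a → toℕ v ≡ c +ℕ a) ⊎ (∃ λ a → toℕ v +ℕ suc a ≡ c)
    side v with c ℕ.≤? toℕ v
    ... | yes c≤v = inj₁ (toℕ v ∸ c , sym (ℕ.m+[n∸m]≡n c≤v))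
    ... | no  c≰v = inj₂ (c ∸ suc (toℕ v) , trans (ℕ.+-suc (toℕ v) _) (ℕ.m+[n∸m]≡n (ℕ.≰⇒> c≰v)))

    -- Away from the last vertex the reflection is v ↦ 2c - v with no reduction modulo `n`; the last
    -- vertex is fixed and is left to `σ-wrap`.
    σ-sum : ∀ {v} → toℕ (rotate 1 v) ≡ suc (toℕ v) → toℕ (σ v) +ℕ toℕ v ≡ c +ℕ c
    σ-sum {v} p = ℕ.suc-injective (ℕ.suc-injective (begin
      suc (suc (toℕ (σ v) +ℕ toℕ v))          ≡⟨ trans (ℕ.+-suc _ _) (cong suc (ℕ.+-suc _ _)) ⟨
      toℕ (σ v) +ℕ suc (suc (toℕ v))          ≡⟨ cong (λ i → toℕ (σ v) +ℕ suc i) p ⟨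
      toℕ (σ v) +ℕ suc (toℕ (rotate 1 v))     ≡⟨ trans (opposite-sum (rotate 1 v)) n≡2c+2 ⟩
      suc (suc (c *ℕ 2))                      ≡⟨ cong (2 +ℕ_) (m+m≡m*2 c) ⟨
      suc (suc (c +ℕ c))                      ∎))

    σ-wrap : ∀ {v} → suc (toℕ v) ≡ n → toℕ (rotate 1 v) ≡ 0 → σ v ≡ v
    σ-wrap {v} p q = toℕ-injective (trans (opposite-prop (rotate 1 v))
      (trans (cong (λ i → n ∸ suc i) q) (sym (cong (_∸ 1) p))))

    σ-right : ∀ {v a} → toℕ (rotate 1 v) ≡ suc (toℕ v) → toℕ v +ℕ a ≡ c → toℕ (σ v) ≡ c +ℕ a
    σ-right {v} {a} p eq = ℕ.+-cancelʳ-≡ (toℕ v) _ _ (begin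
      toℕ (σ v) +ℕ toℕ v   ≡⟨ σ-sum p ⟩
      c +ℕ c               ≡⟨ cong (c +ℕ_) (trans (sym eq) (ℕ.+-comm (toℕ v) a)) ⟩
      c +ℕ (a +ℕ toℕ v)    ≡⟨ ℕ.+-assoc c a (toℕ v) ⟨
      c +ℕ a +ℕ toℕ v      ∎)

    dist-σ : ∀ v → dist (σ v) ≡ dist v
    dist-σ v with rotate-1-cases v
    ... | inj₂ (p , q) = cong dist (σ-wrap p q)
    ... | inj₁ p with side v
    ...   | inj₂ (a , eq) = trans (dist-right {σ v} (σ-right p eq)) (sym (dist-left {v} eq))
    ...   | inj₁ (a , eq) = trans (dist-left {σ v} (ℕ.+-cancelˡ-≡ c _ _ (begin
      c +ℕ (toℕ (σ v) +ℕ a)    ≡⟨ solve 3 (λ c s a → c :+ (s :+ a) := s :+ (c :+ a)) refl c (toℕ (σ v)) a ⟩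
      toℕ (σ v) +ℕ (c +ℕ a)    ≡⟨ cong (toℕ (σ v) +ℕ_) eq ⟨
      toℕ (σ v) +ℕ toℕ v       ≡⟨ σ-sum p ⟩
      c +ℕ c                   ∎))) (sym (dist-right {v} eq))
      where open ℕ-Solver

    n≡ : n ≡ c +ℕ suc (suc c)
    n≡ = trans n≡2c+2 (trans (cong (2 +ℕ_) (sym (m+m≡m*2 c))) (sym (trans (ℕ.+-suc c (suc c)) (cong suc (ℕ.+-suc c c)))))

    dist-< : ∀ v → dist v < suc (suc c)
    dist-< v with side v
    ... | inj₁ (a , eq) = ℕ.+-cancelˡ-< c _ _ (≡.subst₂ _<_ (trans eq (cong (c +ℕ_) (sym (dist-right {v} eq)))) n≡ (toℕ<n v))
    ... | inj₂ (a , eq) = s≤s (ℕ.m≤n⇒m≤1+n (≡.subst₂ _≤_ (sym (dist-left {v} eq)) eq (ℕ.m≤n+m (suc a) (toℕ v))))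

    Q : Graph
    Q = path (+ suc c)

    h : Fin n → Vertex Q
    h v = fromℕ< (dist-< v)

    toℕ-h : ∀ v → toℕ (h v) ≡ dist v
    toℕ-h v = toℕ-fromℕ< _

    e-< : ∀ (u : Vertex Q) → c +ℕ toℕ u < n
    e-< u = ℕ.≤-trans (ℕ.+-monoʳ-< c (toℕ<n u)) (ℕ.≤-reflexive (sym n≡))

    e : Vertex Q → Fin n
    e u = fromℕ< (e-< u)

    toℕ-e : ∀ u → toℕ (e u) ≡ c +ℕ toℕ u
    toℕ-e u = toℕ-fromℕ< (e-< u)

    e∘h : ∀ v → e (h v) ≡ v ⊎ e (h v) ≡ σ v
    e∘h v = go (side v) (rotate-1-cases v)
      where
      go : (∃ λ a → toℕ v ≡ c +ℕ a) ⊎ (∃ λ a → toℕ v +ℕ suc a ≡ c) →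
           toℕ (rotate 1 v) ≡ suc (toℕ v) ⊎ (suc (toℕ v) ≡ n × toℕ (rotate 1 v) ≡ 0) →
           e (h v) ≡ v ⊎ e (h v) ≡ σ v
      go (inj₁ (a , eq)) _ = inj₁ (toℕ-injective (trans (toℕ-e (h v))
        (trans (cong (c +ℕ_) (trans (toℕ-h v) (dist-right {v} eq))) (sym eq))))
      go (inj₂ (a , eq)) (inj₁ p) = inj₂ (toℕ-injective (trans (toℕ-e (h v))
        (trans (cong (c +ℕ_) (trans (toℕ-h v) (dist-left {v} eq))) (sym (σ-right {v} p eq)))))
      -- Here `v` would be 2c+1 and yet lie to the left of `c`.
      go (inj₂ (a , eq)) (inj₂ (p , _)) = contradiction
        (≡.subst (c <_) (sym (ℕ.suc-injective (trans p (trans n≡2c+2 (cong (2 +ℕ_) (sym (m+m≡m*2 c))))))) (s≤s (ℕ.m≤m+n c c)))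
        (ℕ.≤⇒≯ (ℕ.m+n≤o⇒m≤o (toℕ v) (ℕ.≤-reflexive eq)))

    h-adj : ∀ v → Adj Q (h v) (h (rotate 1 v))
    h-adj v with rotate-1-cases v
    ... | inj₂ (p , q) = inj₂ (begin
      toℕ (h v)                    ≡⟨ toℕ-h v ⟩
      dist v                       ≡⟨ dist-right {v} (ℕ.suc-injective (trans p (trans n≡ (ℕ.+-suc c (suc c))))) ⟩
      suc c                        ≡⟨ cong (λ i → suc ∣ i - c ∣) q ⟨
      suc (dist (rotate 1 v))      ≡⟨ cong suc (toℕ-h (rotate 1 v)) ⟨
      suc (toℕ (h (rotate 1 v)))   ∎)
    ... | inj₁ p with side v
    ...   | inj₁ (a , eq) = inj₁ (begin
      toℕ (h (rotate 1 v))   ≡⟨ toℕ-h (rotate 1 v) ⟩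
      dist (rotate 1 v)      ≡⟨ dist-right {rotate 1 v} (trans p (trans (cong suc eq) (sym (ℕ.+-suc c a)))) ⟩
      suc a                  ≡⟨ cong suc (dist-right {v} eq) ⟨
      suc (dist v)           ≡⟨ cong suc (toℕ-h v) ⟨
      suc (toℕ (h v))        ∎)
    ...   | inj₂ (a , eq) = inj₂ (begin
      toℕ (h v)                    ≡⟨ toℕ-h v ⟩
      dist v                       ≡⟨ dist-left {v} eq ⟩
      suc a                        ≡⟨ cong suc (dist-left {rotate 1 v} (trans (cong (_+ℕ a) p) (trans (sym (ℕ.+-suc (toℕ v) a)) eq))) ⟨
      suc (dist (rotate 1 v))      ≡⟨ cong suc (toℕ-h (rotate 1 v)) ⟨
      suc (toℕ (h (rotate 1 v)))   ∎)

    h∘e : ∀ u → h (e u) ≡ u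
    h∘e u = toℕ-injective (trans (toℕ-h (e u)) (dist-right {e u} (toℕ-e u)))

    e-adj : ∀ {u u′} → toℕ u′ ≡ suc (toℕ u) → e u′ ≡ rotate 1 (e u)
    e-adj {u} {u′} p = rotate-1-suc (begin
      toℕ (e u′)           ≡⟨ toℕ-e u′ ⟩
      c +ℕ toℕ u′          ≡⟨ cong (c +ℕ_) p ⟩
      c +ℕ suc (toℕ u)     ≡⟨ ℕ.+-suc c (toℕ u) ⟩
      suc (c +ℕ toℕ u)     ≡⟨ cong suc (toℕ-e u) ⟨
      suc (toℕ (e u))      ∎)

  reflectionFixed-1 : ∀ ℓ μ → reflectionFixed n 3≤n ℓ μ 1 ≡ P (path (+ suc c)) ℓ μ
  reflectionFixed-1 = reflectionFixed-quotient n 3≤n 1 Q h e h∘e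
    (λ v → toℕ-injective (trans (toℕ-h (σ v)) (trans (dist-σ v) (sym (toℕ-h v)))))
    e∘h h-adj
    (λ {u} {u′} a → e u , e u′ , h∘e u , h∘e u′ , Sum.map e-adj e-adj a)

-- Colorings fixed by the reversal, for each parity

module _ (n : ℕ) .{{_ : NonZero n}} (3≤n : 3 ≤ n) (j : ℕ) (n≡ : n ≡ suc (suc j *ℕ 2)) where

  private
    half : ∀ u → u < suc (suc j) ⇔ u +ℕ u < n
    half u = mk⇔
      (λ lt → ≡.subst₂ (λ a b → suc a ≤ b) (sym (m+m≡m*2 u)) (sym n≡) (s≤s (ℕ.*-monoˡ-≤ 2 (s≤s⁻¹ lt))))
      (λ lt → s≤s (ℕ.*-cancelʳ-≤ u (suc j) 2 (s≤s⁻¹ (≡.subst₂ (λ a b → suc a ≤ b) (m+m≡m*2 u) n≡ lt))))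

    -- A loop at the far end would make `n` even, so the deleted vertex 0 carries the only loop.
    delete-end : ∀ u w → Adj (path (+ j)) u w ⇔ Adj (foldedCycle n (suc (suc j))) (suc u) (suc w)
    delete-end u w = mk⇔ (inj₁ ∘ Sum.map (cong suc) (cong suc))
      (λ { (inj₁ a) → Sum.map ℕ.suc-injective ℕ.suc-injective a
         ; (inj₂ (_ , inj₂ eq)) → contradiction
             (trans (sym (ℕ.suc-injective (trans eq n≡))) (cong suc (m+m≡m*2 (suc (toℕ u)))))
             (m*2≢1+n*2 (suc j) (suc (toℕ u))) })

  reflectionFixed-0-odd : ∀ ℓ μ d → ℓ ≡ μ +ℕ d → reflectionFixed n 3≤n ℓ μ 0 ≡ d *ℕ P (path (+ j)) ℓ μ
  reflectionFixed-0-odd ℓ μ d refl = trans (reflectionFixed-0 n (suc (suc j)) 3≤n half ℓ μ)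
    (P-delete-loop (foldedCycle n (suc (suc j))) (path (+ j)) Perm.id (inj₂ (refl , inj₁ refl)) delete-end μ d)

toℕ-punchIn-fromℕ : ∀ {m} (i : Fin m) → toℕ (punchIn (fromℕ m) i) ≡ toℕ i
toℕ-punchIn-fromℕ zero    = refl
toℕ-punchIn-fromℕ (suc i) = cong suc (toℕ-punchIn-fromℕ i)

-- The size is given through the order of `path z` so that n = 4 needs no separate case: there the
-- two looped vertices are the whole quotient and `path z` is empty.
module _ (n : ℕ) .{{_ : NonZero n}} (3≤n : 3 ≤ n) (z : ℤ) (n≡ : n ≡ suc (suc (order (path z))) *ℕ 2) where

  private
    j : ℕ
    j = order (path z)

    Γ₂ Γ₁ : Graph
    Γ₂ = foldedCycle n (suc (suc j))
    Γ₁ = loopedPath (suc j) (λ u → toℕ u ≡ j) (λ u → toℕ u ℕ.≟ j)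

    half : ∀ u → u < suc (suc j) ⇔ u +ℕ u < n
    half u = mk⇔
      (λ lt → ≡.subst₂ _<_ (sym (m+m≡m*2 u)) (sym n≡) (ℕ.*-monoˡ-< 2 lt))
      (λ lt → ℕ.*-cancelʳ-< 2 u (suc (suc j)) (≡.subst₂ _<_ (m+m≡m*2 u) n≡ lt))

    double-suc : ∀ m → suc (suc (suc m +ℕ suc m)) ≡ suc (suc m) *ℕ 2
    double-suc m = cong (2 +ℕ_) (m+m≡m*2 (suc m))

    delete-first : ∀ u w → Adj Γ₁ u w ⇔ Adj Γ₂ (suc u) (suc w)
    delete-first u w = mk⇔
      (λ { (inj₁ a) → inj₁ (Sum.map (cong suc) (cong suc) a)
         ; (inj₂ (refl , l)) → inj₂ (refl , inj₂ (trans (double-suc (toℕ u)) (trans (cong (λ i → suc (suc i) *ℕ 2) l) (sym n≡)))) })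
      (λ { (inj₁ a) → inj₁ (Sum.map ℕ.suc-injective ℕ.suc-injective a)
         ; (inj₂ (refl , inj₂ l)) → inj₂ (refl , ℕ.suc-injective (ℕ.suc-injective
             (ℕ.*-cancelʳ-≡ _ _ 2 (trans (sym (double-suc (toℕ u))) (trans l n≡))))) })

    -- Brings the last vertex, which carries the remaining loop, to the front and keeps the order of
    -- the others.
    π : Permutation (suc j) (suc j)
    π = insert zero (fromℕ j) Perm.id

    toℕ-π : ∀ i → toℕ (π ⟨$⟩ʳ suc i) ≡ toℕ i
    toℕ-π i = trans (cong toℕ (insert-punchIn zero (fromℕ j) Perm.id i)) (toℕ-punchIn-fromℕ i)

    delete-last : ∀ u w → Adj (path z) u w ⇔ Adj Γ₁ (π ⟨$⟩ʳ suc u) (π ⟨$⟩ʳ suc w)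
    delete-last u w = mk⇔
      (λ a → inj₁ (Sum.map (shift u w) (shift w u) a))
      (λ { (inj₁ a) → Sum.map (unshift u w) (unshift w u) a
         ; (inj₂ (_ , l)) → contradiction (trans (sym (toℕ-π u)) l) (ℕ.<⇒≢ (toℕ<n u)) })
      where
      shift : ∀ u w → toℕ w ≡ suc (toℕ u) → toℕ (π ⟨$⟩ʳ suc w) ≡ suc (toℕ (π ⟨$⟩ʳ suc u))
      shift u w eq = trans (toℕ-π w) (trans eq (cong suc (sym (toℕ-π u))))
      unshift : ∀ u w → toℕ (π ⟨$⟩ʳ suc w) ≡ suc (toℕ (π ⟨$⟩ʳ suc u)) → toℕ w ≡ suc (toℕ u)
      unshift u w eq = trans (sym (toℕ-π w)) (trans eq (cong suc (toℕ-π u)))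

  reflectionFixed-0-even : ∀ ℓ μ d → ℓ ≡ μ +ℕ d → reflectionFixed n 3≤n ℓ μ 0 ≡ d *ℕ (d *ℕ P (path z) ℓ μ)
  reflectionFixed-0-even ℓ μ d refl = begin
    reflectionFixed n 3≤n ℓ μ 0    ≡⟨ reflectionFixed-0 n (suc (suc j)) 3≤n half ℓ μ ⟩
    P Γ₂ ℓ μ                       ≡⟨ P-delete-loop Γ₂ Γ₁ Perm.id (inj₂ (refl , inj₁ refl)) delete-first μ d ⟩
    d *ℕ P Γ₁ ℓ μ                  ≡⟨ cong (d *ℕ_) (P-delete-loop Γ₁ (path z) π (inj₂ (refl , toℕ-fromℕ j)) delete-last μ d) ⟩
    d *ℕ (d *ℕ P (path z) ℓ μ)     ∎

-- Passage to rational numbers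

ℕ→ℚ-homo-+ : ∀ a b → ℕ→ℚ (a +ℕ b) ≡ ℕ→ℚ a + ℕ→ℚ b
-- `+ k / 1` is normalised by a gcd that does not compute for a variable `k`. The identity is
-- therefore checked on unnormalised fractions with denominator 1.
ℕ→ℚ-homo-+ a b = ℚ.toℚᵘ-injective (ℚᵘ.≃-trans (ℚ.toℚᵘ-fromℚᵘ (mkℚᵘ (+ (a +ℕ b)) 0))
  (ℚᵘ.≃-trans (*≡* (cong (ℤ._* + 1) (cong₂ ℤ._+_ (sym (ℤ.*-identityʳ (+ a))) (sym (ℤ.*-identityʳ (+ b))))))
  (ℚᵘ.≃-trans (ℚᵘ.+-cong (ℚᵘ.≃-sym (ℚ.toℚᵘ-fromℚᵘ (mkℚᵘ (+ a) 0))) (ℚᵘ.≃-sym (ℚ.toℚᵘ-fromℚᵘ (mkℚᵘ (+ b) 0))))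
  (ℚᵘ.≃-sym (ℚ.toℚᵘ-homo-+ (ℕ→ℚ a) (ℕ→ℚ b))))))

ℕ→ℚ-homo-* : ∀ a b → ℕ→ℚ (a *ℕ b) ≡ ℕ→ℚ a * ℕ→ℚ b
ℕ→ℚ-homo-* a b = ℚ.toℚᵘ-injective (ℚᵘ.≃-trans (ℚ.toℚᵘ-fromℚᵘ (mkℚᵘ (+ (a *ℕ b)) 0))
  (ℚᵘ.≃-trans (*≡* (cong (ℤ._* + 1) (ℤ.pos-* a b)))
  (ℚᵘ.≃-trans (ℚᵘ.*-cong (ℚᵘ.≃-sym (ℚ.toℚᵘ-fromℚᵘ (mkℚᵘ (+ a) 0))) (ℚᵘ.≃-sym (ℚ.toℚᵘ-fromℚᵘ (mkℚᵘ (+ b) 0))))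
  (ℚᵘ.≃-sym (ℚ.toℚᵘ-homo-* (ℕ→ℚ a) (ℕ→ℚ b))))))

ℕ→ℚ-homo-∸ : ∀ m d → ℕ→ℚ (m +ℕ d) - ℕ→ℚ m ≡ ℕ→ℚ d
ℕ→ℚ-homo-∸ m d = trans (cong (λ x → x - ℕ→ℚ m) (ℕ→ℚ-homo-+ m d))
  (solve 2 (λ m d → m :+ d :- m := d) refl (ℕ→ℚ m) (ℕ→ℚ d))
  where open ℚ-Solver

halve : ∀ A B d p ℓ μ → ℓ ≡ μ +ℕ d → A *ℕ 2 ≡ B +ℕ d *ℕ p →
        ℕ→ℚ A ≡ ½ * ℕ→ℚ B + ((ℕ→ℚ ℓ - ℕ→ℚ μ) * ½) * ℕ→ℚ p
halve A B d p ℓ μ refl eq = begin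
  ℕ→ℚ A                                       ≡⟨ solve 1 (λ a → a := con ½ :* (a :* con (ℕ→ℚ 2))) refl (ℕ→ℚ A) ⟩
  ½ * (ℕ→ℚ A * ℕ→ℚ 2)                         ≡⟨ cong (λ x → ½ * x) (ℕ→ℚ-homo-* A 2) ⟨
  ½ * ℕ→ℚ (A *ℕ 2)                            ≡⟨ cong (λ k → ½ * ℕ→ℚ k) eq ⟩
  ½ * ℕ→ℚ (B +ℕ d *ℕ p)                       ≡⟨ cong (λ x → ½ * x) (trans (ℕ→ℚ-homo-+ B (d *ℕ p)) (cong (λ x → ℕ→ℚ B + x) (ℕ→ℚ-homo-* d p))) ⟩
  ½ * (ℕ→ℚ B + ℕ→ℚ d * ℕ→ℚ p)                 ≡⟨ solve 3 (λ b d p → con ½ :* (b :+ d :* p) := con ½ :* b :+ (d :* con ½) :* p)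
                                                     refl (ℕ→ℚ B) (ℕ→ℚ d) (ℕ→ℚ p) ⟩
  ½ * ℕ→ℚ B + (ℕ→ℚ d * ½) * ℕ→ℚ p             ≡⟨ cong (λ δ → ½ * ℕ→ℚ B + (δ * ½) * ℕ→ℚ p) (ℕ→ℚ-homo-∸ μ d) ⟨
  ½ * ℕ→ℚ B + ((ℕ→ℚ (μ +ℕ d) - ℕ→ℚ μ) * ½) * ℕ→ℚ p ∎
  where open ℚ-Solver

quarter : ∀ A B d p q ℓ μ → ℓ ≡ μ +ℕ d → A *ℕ 4 ≡ B *ℕ 2 +ℕ (d *ℕ (d *ℕ q) +ℕ p) →
          ℕ→ℚ A ≡ ½ * ℕ→ℚ B + (+ 1 / 4) * ℕ→ℚ p + ((ℕ→ℚ ℓ - ℕ→ℚ μ) * (ℕ→ℚ ℓ - ℕ→ℚ μ) * (+ 1 / 4)) * ℕ→ℚ q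
quarter A B d p q ℓ μ refl eq = begin
  ℕ→ℚ A                                       ≡⟨ solve 1 (λ a → a := con ¼ :* (a :* con (ℕ→ℚ 4))) refl (ℕ→ℚ A) ⟩
  ¼ * (ℕ→ℚ A * ℕ→ℚ 4)                         ≡⟨ cong (λ x → ¼ * x) (ℕ→ℚ-homo-* A 4) ⟨
  ¼ * ℕ→ℚ (A *ℕ 4)                            ≡⟨ cong (λ k → ¼ * ℕ→ℚ k) eq ⟩
  ¼ * ℕ→ℚ (B *ℕ 2 +ℕ (d *ℕ (d *ℕ q) +ℕ p))    ≡⟨ cong (λ x → ¼ * x) homo ⟩
  ¼ * (ℕ→ℚ B * ℕ→ℚ 2 + (ℕ→ℚ d * (ℕ→ℚ d * ℕ→ℚ q) + ℕ→ℚ p))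
    ≡⟨ solve 4 (λ b d p q → con ¼ :* (b :* con (ℕ→ℚ 2) :+ (d :* (d :* q) :+ p))
         := con ½ :* b :+ con ¼ :* p :+ (d :* d :* con ¼) :* q)
         refl (ℕ→ℚ B) (ℕ→ℚ d) (ℕ→ℚ p) (ℕ→ℚ q) ⟩
  rhs (ℕ→ℚ d)                                 ≡⟨ cong rhs (ℕ→ℚ-homo-∸ μ d) ⟨
  rhs (ℕ→ℚ (μ +ℕ d) - ℕ→ℚ μ)                  ∎
  where
  open ℚ-Solver
  ¼ : ℚ
  ¼ = + 1 / 4
  rhs : ℚ → ℚ
  rhs δ = ½ * ℕ→ℚ B + ¼ * ℕ→ℚ p + (δ * δ * ¼) * ℕ→ℚ q
  homo : ℕ→ℚ (B *ℕ 2 +ℕ (d *ℕ (d *ℕ q) +ℕ p)) ≡ ℕ→ℚ B * ℕ→ℚ 2 + (ℕ→ℚ d * (ℕ→ℚ d * ℕ→ℚ q) + ℕ→ℚ p)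
  homo = trans (ℕ→ℚ-homo-+ (B *ℕ 2) _) (cong₂ _+_ (ℕ→ℚ-homo-* B 2)
    (trans (ℕ→ℚ-homo-+ (d *ℕ (d *ℕ q)) p) (cong (λ x → x + ℕ→ℚ p)
      (trans (ℕ→ℚ-homo-* d (d *ℕ q)) (cong (λ x → ℕ→ℚ d * x) (ℕ→ℚ-homo-* d q))))))

-- Parity of the cycle length and assembly of the two formulas

m*2/2≡m : ∀ m → m *ℕ 2 div 2 ≡ m
m*2/2≡m m = m*n/n≡m m 2

odd-double : ∀ n → 2 ∤ n → ∃ λ k → n ≡ suc (k *ℕ 2)
odd-double n 2∤n with n % 2 in eq | m%n<n n 2
... | zero        | _ = contradiction (m%n≡0⇒n∣m n 2 eq) 2∤n
... | suc zero    | _ = n div 2 , trans (m≡m%n+[m/n]*n n 2) (cong (_+ℕ n div 2 *ℕ 2) eq)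
... | suc (suc _) | s≤s (s≤s ())

-- Once `q` is split the integer subtraction computes. For q = 2 it gives -1, the index of the empty
-- graph, whose order 0 still fits the equation.
order-path-minus-3 : ∀ {n} q → n ≡ q *ℕ 2 → 3 ≤ n → q ≡ suc (suc (order (path (+ q ℤ.- + 3))))
order-path-minus-3 (suc zero)          refl (s≤s (s≤s ()))
order-path-minus-3 (suc (suc zero))    _    _ = refl
order-path-minus-3 (suc (suc (suc _))) _    _ = refl
order-path-minus-3 zero                refl ()

theorem11 : ∀ (n ℓ μ : ℕ) .{{_ : NonZero n}} .{{_ : NonZero ℓ}} → 3 ≤ n → μ ≤ ℓ →
    (2 ∤ n →
      ℕ→ℚ (OP (cycle n) (Aut (cycle n)) ℓ μ)
        ≡ ½ * ℕ→ℚ (OP (cycle n) (Rot n) ℓ μ)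
          + ((ℕ→ℚ ℓ - ℕ→ℚ μ) * ½) * ℕ→ℚ (P (path (+ ((n ∸ 3) div 2))) ℓ μ))
    × (2 ∣ n →
      ℕ→ℚ (OP (cycle n) (Aut (cycle n)) ℓ μ)
        ≡ ½ * ℕ→ℚ (OP (cycle n) (Rot n) ℓ μ)
          + (+ 1 / 4) * ℕ→ℚ (P (path (+ (n div 2))) ℓ μ)
          + ((ℕ→ℚ ℓ - ℕ→ℚ μ) * (ℕ→ℚ ℓ - ℕ→ℚ μ) * (+ 1 / 4)) * ℕ→ℚ (P (path (+ (n div 2) ℤ.- + 3)) ℓ μ))
theorem11 n ℓ μ 3≤n μ≤ℓ = (λ 2∤n → odd (odd-double n 2∤n)) , even
  where
  A B d : ℕ
  A = OP (cycle n) (Aut (cycle n)) ℓ μ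
  B = OP (cycle n) (Rot n) ℓ μ
  d = ℓ ∸ μ
  ℓ≡ : ℓ ≡ μ +ℕ d
  ℓ≡ = sym (ℕ.m+[n∸m]≡n μ≤ℓ)
  p : ℤ → ℕ
  p z = P (path z) ℓ μ
  odd : (∃ λ k → n ≡ suc (k *ℕ 2)) →
        ℕ→ℚ A ≡ ½ * ℕ→ℚ B + ((ℕ→ℚ ℓ - ℕ→ℚ μ) * ½) * ℕ→ℚ (p (+ ((n ∸ 3) div 2)))
  odd (zero  , eq) = contradiction (≡.subst (3 ≤_) eq 3≤n) λ { (s≤s ()) }
  odd (suc j , eq) = halve A B d (p (+ i)) ℓ μ ℓ≡ (trans (odd-orbits n 3≤n ℓ μ (suc j) eq)
    (cong (B +ℕ_) (reflectionFixed-0-odd n 3≤n i (trans eq (cong (λ j → suc (suc j *ℕ 2)) (sym i≡j))) ℓ μ d ℓ≡)))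
    where
    i : ℕ
    i = (n ∸ 3) div 2
    i≡j : i ≡ j
    i≡j = trans (cong (λ n → (n ∸ 3) div 2) eq) (m*2/2≡m j)
  even : 2 ∣ n →
         ℕ→ℚ A ≡ ½ * ℕ→ℚ B + (+ 1 / 4) * ℕ→ℚ (p (+ (n div 2)))
                 + ((ℕ→ℚ ℓ - ℕ→ℚ μ) * (ℕ→ℚ ℓ - ℕ→ℚ μ) * (+ 1 / 4)) * ℕ→ℚ (p (+ (n div 2) ℤ.- + 3))
  even (divides q n≡q*2) = quarter A B d (p (+ k)) (p z) ℓ μ ℓ≡ (trans (even-orbits n 3≤n ℓ μ k n≡)
    (cong (B *ℕ 2 +ℕ_) (cong₂ _+ℕ_
      (reflectionFixed-0-even n 3≤n z (trans n≡ (cong (_*ℕ 2) k≡)) ℓ μ d ℓ≡)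
      -- The centre of this reflection is c = n/2 - 1, so the path of length c + 1 has length n/2.
      (trans (reflectionFixed-1 n 3≤n (suc (order (path z))) (trans n≡ (cong (_*ℕ 2) k≡)) ℓ μ)
             (cong (λ i → p (+ i)) (sym k≡))))))
    where
    k : ℕ
    k = n div 2
    z : ℤ
    z = + k ℤ.- + 3
    n≡ : n ≡ k *ℕ 2
    n≡ = trans n≡q*2 (cong (_*ℕ 2) (sym (trans (cong (_div 2) n≡q*2) (m*2/2≡m q))))
    k≡ : k ≡ suc (suc (order (path z)))
    k≡ = order-path-minus-3 k n≡ 3≤n
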